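{- Let $k\geq 1$ be an integer and let $n\geq GR_k(K_3)$. Write $n=5^{\lfloor(k-1)/2\rfloor}m+r$, where $m$ and $r$ are nonnegative integers with $0\leq r\leq 5^{\lfloor(k-1)/2\rfloor}-1$. Then $$g_{k}(K_3,n)\leq \begin{cases} r\binom{m+1}{3}+\left(5^{(k-1)/2}-r\right)\binom{m}{3}, & \text{if $k$ is odd},\\ rM_2(K_3, m+1)+\left(5^{(k-2)/2}-r\right)M_2(K_3, m), & \text{if $k$ is even}.\end{cases}$$ Moreover, letting $s_0=1$ if $k$ is odd and $s_0=2$ if $k$ is even, $$g_{k}(K_3,n)\geq \frac{s_0n(n-1)(n-2)}{GR_k(K_3)(GR_k(K_3)-1)(GR_k(K_3)-2)}.$$
   Context: A $k$-edge-coloring of a graph is a map from its edge set to $[k]=\{1,\dots,k\}$ (not necessarily proper). A subgraph is rainbow if all its edges have distinct colors and monochromatic if all its edges have the same color. A Gallai-$k$-coloring is a $k$-edge-coloring of a complete graph containing no rainbow triangle. $GR_k(K_3)$ is the minimum integer $N$ such that every Gallai-$k$-coloring of $K_N$ contains a monochromatic triangle. $g_k(K_3,n)$ is the minimum number of monochromatic triangles (as subgraphs) taken over all Gallai-$k$-colorings of $K_n$. $M_2(K_3,m)$ is the minimum number of monochromatic triangles taken over all $2$-edge-colorings of $K_m$. By convention $\binom{a}{3}=0$ for $a<3$. -}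

module Defs where

open import Data.Nat using (ℕ; zero; suc; _+_; _*_; _∸_; _^_; _≤_; _<_; _%_; _/_)
open import Data.Fin using (Fin; toℕ)
open import Data.Fin.Properties using (_≟_)
open import Data.List using (List; map; allFin)
open import Data.Nat.ListAction using (sum)
open import Data.Product using (_×_; Σ; ∃; _,_)
open import Relation.Binary.PropositionalEquality using (_≡_; _≢_)
open import Relation.Nullary using (¬_; Dec; yes; no)
open import Relation.Nullary.Decidable using (_×-dec_; ¬?)
import Data.Nat as ℕ

-- A k-edge-coloring of K_n (vertex set Fin n). The edge {i,j} with
-- toℕ i < toℕ j receives colour c i j; values c i j with toℕ i ≥ toℕ j are
-- ignored. (Colours are Fin k, i.e. [k].)
Coloring : ℕ → ℕ → Set
Coloring k n = Fin n → Fin n → Fin k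

Ordered3 : ∀ {n} → Fin n → Fin n → Fin n → Set
Ordered3 i j l = (toℕ i < toℕ j) × (toℕ j < toℕ l)

Mono : ∀ {k n} → Coloring k n → Fin n → Fin n → Fin n → Set
Mono c i j l = (c i j ≡ c i l) × (c i j ≡ c j l)

Rainbow : ∀ {k n} → Coloring k n → Fin n → Fin n → Fin n → Set
Rainbow c i j l = (c i j ≢ c i l) × (c i j ≢ c j l) × (c i l ≢ c j l)

Gallai : ∀ {k n} → Coloring k n → Set
Gallai {n = n} c = (i j l : Fin n) → Ordered3 i j l → ¬ Rainbow c i j l

HasMonoTriangle : ∀ {k n} → Coloring k n → Set
HasMonoTriangle {n = n} c = ∃ λ i → ∃ λ j → ∃ λ l → Ordered3 i j l × Mono c i j l

private
  indicator : ∀ {P : Set} → Dec P → ℕ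
  indicator (yes _) = 1
  indicator (no _)  = 0

  ord3? : ∀ {n} (i j l : Fin n) → Dec (Ordered3 i j l)
  ord3? i j l = (toℕ i ℕ.<? toℕ j) ×-dec (toℕ j ℕ.<? toℕ l)

  mono? : ∀ {k n} (c : Coloring k n) (i j l : Fin n) → Dec (Mono c i j l)
  mono? c i j l = (c i j ≟ c i l) ×-dec (c i j ≟ c j l)

monoCount : ∀ {k n} → Coloring k n → ℕ
monoCount {n = n} c =
  sum (map (λ i → sum (map (λ j → sum (map (λ l →
    indicator (ord3? i j l ×-dec mono? c i j l)) (allFin n))) (allFin n))) (allFin n))

GallaiForces : ℕ → ℕ → Set
GallaiForces k N = (c : Coloring k N) → Gallai c → HasMonoTriangle c

IsGR : ℕ → ℕ → Set
IsGR k N = GallaiForces k N × (∀ N' → N' < N → ¬ GallaiForces k N')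

IsGMin : ℕ → ℕ → ℕ → Set
IsGMin k n g =
  (Σ (Coloring k n) λ c → Gallai c × monoCount c ≡ g) ×
  ((c : Coloring k n) → Gallai c → g ≤ monoCount c)

IsM2 : ℕ → ℕ → Set
IsM2 m M =
  (Σ (Coloring 2 m) λ c → monoCount c ≡ M) ×
  ((c : Coloring 2 m) → M ≤ monoCount c)

s0 : ℕ → ℕ
s0 k with k % 2
... | 0 = 2
... | _ = 1

{-# OPTIONS --safe #-}

-- Upper bound: repeatedly substituting five blocks into the pentagon colouring of K₅ (two new
-- colours, no monochromatic triangle) gives 5^t blocks between which no triangle is monochromatic,
-- so the monochromatic triangles of the blocks just add up.
--
-- Lower bound: each monochromatic triangle of K_{n+1} survives in n − 2 of its n + 1 vertex-deleted
-- subgraphs, so it suffices to find s₀ of them in K_N. For odd k this is the definition of N. For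
-- k = 2t the substitution above gives N > 5^t, and more than 5^t vertices force two triangles, by
-- induction along Gallai's theorem: for some colours p, q the graph of the other edges is
-- disconnected, and its components are homogeneous. Either some component sees all others in one
-- colour r, splitting the vertices into two parts without r; or every component sees both colours,
-- hence contains neither, and by Goodman's theorem there are at most five components. For
-- triangle-free colourings this yields n² ≤ 5^k; a single monochromatic triangle can only be
-- transversal to the components if one of its vertices is a component by itself.
module Submission where

open import Defs
open import Data.Bool using (if_then_else_; _∨_)
open import Data.Empty using (⊥; ⊥-elim)
open import Data.Fin using (Fin; zero; suc; toℕ; punchIn; inject≤; _↑ˡ_; _↑ʳ_)
open import Data.Fin.Properties
  using (_≟_; toℕ<n; toℕ-injective; toℕ-inject≤; toℕ-↑ˡ; toℕ-↑ʳ; ↑ʳ-injective; punchIn-mono-≤; punchIn-cancel-≤)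
  renaming (all? to all-Fin?)
open import Data.List
  using (List; []; _∷_; _++_; map; length; filter; lookup; tabulate; allFin; concatMap; replicate)
import Data.List.Properties as List
open import Data.List.Membership.Propositional using (_∈_; find; lose)
open import Data.List.Membership.Propositional.Properties
  using (∈-filter⁺; ∈-filter⁻; ∈-length; ∈-map⁻; ∈-concatMap⁻; ∈-allFin)
open import Data.List.Relation.Binary.Subset.Propositional using (_⊆_)
open import Data.List.Relation.Unary.All as All using (All; []; _∷_; all?)
import Data.List.Relation.Unary.All.Properties as All
open import Data.List.Relation.Unary.AllPairs as AllPairs using ([]; _∷_)
open import Data.List.Relation.Unary.Any using (Any; here; there; any?)
open import Data.List.Relation.Unary.Unique.Propositional using (Unique)
import Data.List.Relation.Unary.Unique.Propositional.Properties as Unique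
open import Data.Nat hiding (_≟_)
open import Data.Nat.Combinatorics using (_C_; nC1≡n; nCk+nC[k+1]≡[n+1]C[k+1])
open import Data.Nat.DivMod using (m≡m%n+[m/n]*n; m%n<n; m*n/n≡m; +-distrib-/-∣ʳ)
open import Data.Nat.Divisibility using (divides)
open import Data.Nat.Induction using (<-rec)
open import Data.Nat.ListAction using () renaming (sum to sumList)
open import Data.Nat.ListAction.Properties using (sum-++)
open import Data.Nat.Properties hiding (_≟_)
open import Data.Nat.Tactic.RingSolver using (solve-∀)
open import Data.Product using (_×_; _,_; ∃; ∃₂; Σ; proj₁; proj₂)
open import Data.Sum as Sum using (_⊎_; inj₁; inj₂; [_,_]′)
open import Data.Unit using (⊤; tt)
open import Data.Vec using (Vec; []; _∷_; concat; group)
  renaming (_++_ to _++ᵛ_; lookup to lookupᵛ; replicate to replicateᵛ)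
open import Function using (_∘_; id)
open import Level using (0ℓ)
open import Relation.Binary using (DecidableEquality; tri<; tri≈; tri>)
open import Relation.Binary.PropositionalEquality
open import Relation.Nullary
open import Relation.Nullary.Decidable
  using (_×-dec_; _⊎-dec_; _→-dec_; ¬?; dec-true; dec-false; from-yes; decidable-stable)
open import Relation.Unary using (Pred; Decidable)
open import Relation.Unary.Properties using (∁?)
open import Algebra.Properties.CommutativeMonoid.Sum +-0-commutativeMonoid
  using (sum; sum-syntax; sum-cong-≗; sum-remove; sum-replicate-zero; ∑-distrib-+; ∑-comm)

-- Counting monochromatic triangles

-- The difficulty is to keep the exact bound 5^t while one monochromatic triangle is allowed. An
-- edge of colour r inside a component and an edge of colour r leaving it from the same vertex
-- complete, by homogeneity, a triangle that is not inside one component. So if every triangle lies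
-- inside a component, no vertex has an inner and an outgoing edge of equal colour. A blow-up then
-- trades two colours for a factor 5 in n, which fits the exact bound. A split trades one colour for
-- a factor 2 and leaves an odd number of colours; hence the bound n² ≤ 5^k, blind to parity, for
-- triangle-free colourings: a colour is worth a factor 5 in n², and a split spends only 4. What is
-- saved pays for the exceptional triangle. With 2t ≥ 4 colours, the two parts have fewer than 12 *
-- 5^(t-2) vertices each once two vertices have been deleted to destroy triangles, and 12 + 12 ≤ 25
-- leaves room for these two. For two colours there is no such room, and Goodman's theorem is
-- applied directly.

Triangle : ∀ {k n} → Coloring k n → Fin n → Fin n → Fin n → Set
Triangle c i j l = Ordered3 i j l × Mono c i j l

triangle? : ∀ {k n} (c : Coloring k n) i j l → Dec (Triangle c i j l)
triangle? c i j l =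
  ((toℕ i <? toℕ j) ×-dec (toℕ j <? toℕ l)) ×-dec ((c i j ≟ c i l) ×-dec (c i j ≟ c j l))

tripleSum : ∀ n → (Fin n → Fin n → Fin n → ℕ) → ℕ
tripleSum n f =
  sumList (map (λ i → sumList (map (λ j → sumList (map (f i j) (allFin n))) (allFin n))) (allFin n))

-- The indicator used by monoCount is private to Defs; unification recovers it.
χ : ∀ {k n} → Coloring k n → Fin n → Fin n → Fin n → ℕ
monoCount≡tripleSum : ∀ {k n} (c : Coloring k n) → monoCount c ≡ tripleSum n (χ c)
χ c = _
monoCount≡tripleSum c = refl

χ-yes : ∀ {k n} (c : Coloring k n) i j l → Triangle c i j l → χ c i j l ≡ 1
χ-yes c i j l p with triangle? c i j l
... | yes _ = refl
... | no ¬p = contradiction p ¬p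

χ-no : ∀ {k n} (c : Coloring k n) i j l → ¬ Triangle c i j l → χ c i j l ≡ 0
χ-no c i j l ¬p with triangle? c i j l
... | yes p = contradiction p ¬p
... | no _ = refl

χ-cong : ∀ {k k′ n n′} (c : Coloring k n) (c′ : Coloring k′ n′) {i j l i′ j′ l′} →
  (Triangle c i j l → Triangle c′ i′ j′ l′) → (Triangle c′ i′ j′ l′ → Triangle c i j l) →
  χ c i j l ≡ χ c′ i′ j′ l′
χ-cong c c′ {i} {j} {l} {i′} {j′} {l′} f g with triangle? c i j l
... | yes p = sym (χ-yes c′ i′ j′ l′ (f p))
... | no ¬p = sym (χ-no c′ i′ j′ l′ (¬p ∘ g))

sumList-allFin : ∀ n (f : Fin n → ℕ) → sumList (map f (allFin n)) ≡ sum f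
sumList-allFin n f = trans (cong sumList (List.map-tabulate id f)) (go n f)
  where
  go : ∀ n (f : Fin n → ℕ) → sumList (tabulate f) ≡ sum f
  go zero f = refl
  go (suc n) f = cong (f zero +_) (go n (f ∘ suc))

monoCount≡∑ : ∀ {k n} (c : Coloring k n) → monoCount c ≡ ∑[ i < n ] ∑[ j < n ] ∑[ l < n ] χ c i j l
monoCount≡∑ {n = n} c = trans (sumList-allFin n _) (sum-cong-≗ λ i →
  trans (sumList-allFin n _) (sum-cong-≗ λ j → sumList-allFin n (χ c i j)))

sum-≡0 : ∀ {n} (f : Fin n → ℕ) → (∀ i → f i ≡ 0) → sum f ≡ 0
sum-≡0 {n} f f≡0 = trans (sum-cong-≗ f≡0) (sum-replicate-zero n)

term≤sum : ∀ {n} (f : Fin n → ℕ) i → f i ≤ sum f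
term≤sum f zero = m≤m+n (f zero) _
term≤sum f (suc i) = ≤-trans (term≤sum (f ∘ suc) i) (m≤n+m _ (f zero))

sum-mono-≤ : ∀ {n} {f g : Fin n → ℕ} → (∀ i → f i ≤ g i) → sum f ≤ sum g
sum-mono-≤ {zero} f≤g = z≤n
sum-mono-≤ {suc n} f≤g = +-mono-≤ (f≤g zero) (sum-mono-≤ (f≤g ∘ suc))

sum-const : ∀ n m → ∑[ i < n ] m ≡ n * m
sum-const zero m = refl
sum-const (suc n) m = cong (m +_) (sum-const n m)

sum-*ʳ : ∀ {n} (f : Fin n → ℕ) m → ∑[ i < n ] (f i * m) ≡ sum f * m
sum-*ʳ {zero} f m = refl
sum-*ʳ {suc n} f m = trans (cong (f zero * m +_) (sum-*ʳ (f ∘ suc) m)) (sym (*-distribʳ-+ m (f zero) _))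

sum≤1-unique : ∀ {n} (f : Fin n → ℕ) → sum f ≤ 1 → ∀ {i j} → 1 ≤ f i → 1 ≤ f j → i ≡ j
sum≤1-unique f s {zero} {zero} p q = refl
sum≤1-unique f s {zero} {suc j} p q =
  contradiction (≤-trans (+-mono-≤ p (≤-trans q (term≤sum (f ∘ suc) j))) s) λ { (s≤s ()) }
sum≤1-unique f s {suc i} {zero} p q =
  contradiction (≤-trans (+-mono-≤ q (≤-trans p (term≤sum (f ∘ suc) i))) s) λ { (s≤s ()) }
sum≤1-unique f s {suc i} {suc j} p q = cong suc (sum≤1-unique (f ∘ suc) (≤-trans (m≤n+m _ (f zero)) s) p q)

χ≤monoCount : ∀ {k n} (c : Coloring k n) i j l → χ c i j l ≤ monoCount c
χ≤monoCount c i j l = ≤-trans (term≤sum (χ c i j) l) (≤-trans (term≤sum _ j)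
  (≤-trans (term≤sum _ i) (≤-reflexive (sym (monoCount≡∑ c)))))

HasMonoTriangle⇒1≤monoCount : ∀ {k n} (c : Coloring k n) → HasMonoTriangle c → 1 ≤ monoCount c
HasMonoTriangle⇒1≤monoCount c (i , j , l , t) =
  ≤-trans (≤-reflexive (sym (χ-yes c i j l t))) (χ≤monoCount c i j l)

-- A sum of naturals bounded by 1 has at most one positive term. Applied to the three nested sums
-- from the outside in, this identifies i, then j, then l.
monoCount≤1-unique : ∀ {k n} (c : Coloring k n) → monoCount c ≤ 1 → ∀ {i j l i′ j′ l′} →
  Triangle c i j l → Triangle c i′ j′ l′ → i ≡ i′ × j ≡ j′ × l ≡ l′
monoCount≤1-unique {n = n} c s {i} {j} {l} {i′} {j′} {l′} t t′
  with sum≤1-unique (λ i → ∑[ j < n ] ∑[ l < n ] χ c i j l) s₁ {i} {i′} (big t) (big t′)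
  where
  s₁ = subst (_≤ 1) (monoCount≡∑ c) s
  big : ∀ {i j l} → Triangle c i j l → 1 ≤ ∑[ j < n ] ∑[ l < n ] χ c i j l
  big {i} {j} {l} t = ≤-trans (≤-trans (≤-reflexive (sym (χ-yes c i j l t))) (term≤sum _ l)) (term≤sum _ j)
... | refl with sum≤1-unique (λ j → ∑[ l < n ] χ c i j l) s₂ {j} {j′} (big t) (big t′)
  where
  s₂ = ≤-trans (term≤sum _ i) (subst (_≤ 1) (monoCount≡∑ c) s)
  big : ∀ {i j l} → Triangle c i j l → 1 ≤ ∑[ l < n ] χ c i j l
  big {i} {j} {l} t = ≤-trans (≤-reflexive (sym (χ-yes c i j l t))) (term≤sum _ l)
... | refl = refl , refl , sum≤1-unique (χ c i j) s₃ (big t) (big t′)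
  where
  s₃ = ≤-trans (≤-trans (term≤sum _ j) (term≤sum _ i)) (subst (_≤ 1) (monoCount≡∑ c) s)
  big : ∀ {i j l} → Triangle c i j l → 1 ≤ χ c i j l
  big {i} {j} {l} t = ≤-reflexive (sym (χ-yes c i j l t))

-- Vertex deletion and averaging

punchIn-mono-< : ∀ {n} (v : Fin (suc n)) i j → toℕ i < toℕ j → toℕ (punchIn v i) < toℕ (punchIn v j)
punchIn-mono-< v i j i<j = ≰⇒> (<⇒≱ i<j ∘ punchIn-cancel-≤ v j i)

punchIn-cancel-< : ∀ {n} (v : Fin (suc n)) i j → toℕ (punchIn v i) < toℕ (punchIn v j) → toℕ i < toℕ j
punchIn-cancel-< v i j pi<pj = ≰⇒> (<⇒≱ pi<pj ∘ punchIn-mono-≤ v j i)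

deleteVertex : ∀ {k n} → Coloring k (suc n) → Fin (suc n) → Coloring k n
deleteVertex c v i j = c (punchIn v i) (punchIn v j)

deleteVertex-Gallai : ∀ {k n} (c : Coloring k (suc n)) v → Gallai c → Gallai (deleteVertex c v)
deleteVertex-Gallai c v G i j l (i<j , j<l) =
  G _ _ _ (punchIn-mono-< v i j i<j , punchIn-mono-< v j l j<l)

χ-deleteVertex : ∀ {k n} (c : Coloring k (suc n)) v i j l →
  χ (deleteVertex c v) i j l ≡ χ c (punchIn v i) (punchIn v j) (punchIn v l)
χ-deleteVertex c v i j l = χ-cong (deleteVertex c v) c
  (λ { ((p , q) , m) → (punchIn-mono-< v i j p , punchIn-mono-< v j l q) , m })
  (λ { ((p , q) , m) → (punchIn-cancel-< v i j p , punchIn-cancel-< v j l q) , m })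

module _ {n : ℕ} where

  sum-punchIn-≡0 : ∀ (v : Fin (suc n)) (f : Fin (suc n) → ℕ) → f v ≡ 0 → ∑[ i < n ] f (punchIn v i) ≡ sum f
  sum-punchIn-≡0 v f fv≡0 = sym (trans (sum-remove {i = v} f) (cong (_+ ∑[ i < n ] f (punchIn v i)) fv≡0))

  module _ (F : Fin (suc n) → Fin (suc n) → Fin (suc n) → ℕ)
           (F-iil : ∀ i l → F i i l ≡ 0) (F-ijj : ∀ i j → F i j j ≡ 0) (F-iji : ∀ i j → F i j i ≡ 0) where

    -- The slices i = v, j = v and l = v overlap only in terms with a repeated index. These vanish,
    -- so each slice can be a full double sum and no inclusion-exclusion is needed.
    ∑³-remove : ∀ v → ∑[ i < suc n ] ∑[ j < suc n ] ∑[ l < suc n ] F i j l ≡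
      ∑[ j < suc n ] ∑[ l < suc n ] F v j l + (∑[ i < suc n ] ∑[ l < suc n ] F i v l
      + (∑[ i < suc n ] ∑[ j < suc n ] F i j v
      + ∑[ i < n ] ∑[ j < n ] ∑[ l < n ] F (punchIn v i) (punchIn v j) (punchIn v l)))
    ∑³-remove v = begin
      sum R                                              ≡⟨ sum-remove {i = v} R ⟩
      R v + ∑[ i < n ] R (p i)                           ≡⟨ cong (R v +_) (sum-cong-≗ λ i → sum-remove {i = v} (Q (p i))) ⟩
      R v + ∑[ i < n ] (Q (p i) v + ∑[ j < n ] Q (p i) (p j))
        ≡⟨ cong (R v +_) (∑-distrib-+ (λ i → Q (p i) v) (λ i → ∑[ j < n ] Q (p i) (p j))) ⟩
      R v + (∑[ i < n ] Q (p i) v + ∑[ i < n ] ∑[ j < n ] Q (p i) (p j))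
        ≡⟨ cong (R v +_) (cong₂ _+_ (sum-punchIn-≡0 v (λ i → Q i v) (sum-≡0 (F v v) (F-iil v))) inner) ⟩
      R v + (∑[ i < suc n ] Q i v + (∑[ i < suc n ] P i + ∑[ i < n ] ∑[ j < n ] U i j))  ∎
      where
      open ≡-Reasoning
      p = punchIn v
      Q : Fin (suc n) → Fin (suc n) → ℕ
      Q i j = ∑[ l < suc n ] F i j l
      R P : Fin (suc n) → ℕ
      R i = ∑[ j < suc n ] Q i j
      P i = ∑[ j < suc n ] F i j v
      U : Fin n → Fin n → ℕ
      U i j = ∑[ l < n ] F (p i) (p j) (p l)
      inner : ∑[ i < n ] ∑[ j < n ] Q (p i) (p j) ≡ ∑[ i < suc n ] P i + ∑[ i < n ] ∑[ j < n ] U i j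
      inner = begin
        ∑[ i < n ] ∑[ j < n ] Q (p i) (p j)
          ≡⟨ sum-cong-≗ (λ i → sum-cong-≗ λ j → sum-remove {i = v} (F (p i) (p j))) ⟩
        ∑[ i < n ] ∑[ j < n ] (F (p i) (p j) v + U i j)
          ≡⟨ sum-cong-≗ (λ i → ∑-distrib-+ (λ j → F (p i) (p j) v) (U i)) ⟩
        ∑[ i < n ] (∑[ j < n ] F (p i) (p j) v + ∑[ j < n ] U i j)
          ≡⟨ ∑-distrib-+ (λ i → ∑[ j < n ] F (p i) (p j) v) (λ i → ∑[ j < n ] U i j) ⟩
        ∑[ i < n ] ∑[ j < n ] F (p i) (p j) v + ∑[ i < n ] ∑[ j < n ] U i j
          ≡⟨ cong (_+ ∑[ i < n ] ∑[ j < n ] U i j) (trans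
               (sum-cong-≗ λ i → sum-punchIn-≡0 v (λ j → F (p i) j v) (F-ijj (p i) v))
               (sum-punchIn-≡0 v P (sum-≡0 (λ j → F v j v) (F-iji v)))) ⟩
        ∑[ i < suc n ] P i + ∑[ i < n ] ∑[ j < n ] U i j  ∎

    -- Summing `∑³-remove` over v and exchanging sums turns each of the three slices into S. The
    -- additive form avoids truncated subtraction.
    ∑³-punchIn : let S = ∑[ i < suc n ] ∑[ j < suc n ] ∑[ l < suc n ] F i j l in
      suc n * S ≡ S + (S + (S + ∑[ v < suc n ] ∑[ i < n ] ∑[ j < n ] ∑[ l < n ]
        F (punchIn v i) (punchIn v j) (punchIn v l)))
    ∑³-punchIn = begin
      suc n * sum R                                 ≡⟨ sum-const (suc n) (sum R) ⟨
      ∑[ v < suc n ] (sum R)                        ≡⟨ sum-cong-≗ ∑³-remove ⟩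
      ∑[ v < suc n ] (R v + (R′ v + (R″ v + W v)))  ≡⟨ ∑-distrib-+ R (λ v → R′ v + (R″ v + W v)) ⟩
      sum R + ∑[ v < suc n ] (R′ v + (R″ v + W v))  ≡⟨ cong (sum R +_) (∑-distrib-+ R′ (λ v → R″ v + W v)) ⟩
      sum R + (sum R′ + ∑[ v < suc n ] (R″ v + W v))
        ≡⟨ cong (λ z → sum R + (sum R′ + z)) (∑-distrib-+ R″ W) ⟩
      sum R + (sum R′ + (sum R″ + sum W))
        ≡⟨ cong₂ (λ x y → sum R + (x + (y + sum W)))
             (∑-comm λ v i → ∑[ l < suc n ] F i v l)
             (trans (∑-comm λ v i → ∑[ j < suc n ] F i j v) (sum-cong-≗ λ i → ∑-comm λ v j → F i j v)) ⟩
      sum R + (sum R + (sum R + sum W))             ∎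
      where
      open ≡-Reasoning
      R R′ R″ W : Fin (suc n) → ℕ
      R i = ∑[ j < suc n ] ∑[ l < suc n ] F i j l
      R′ v = ∑[ i < suc n ] ∑[ l < suc n ] F i v l
      R″ v = ∑[ i < suc n ] ∑[ j < suc n ] F i j v
      W v = ∑[ i < n ] ∑[ j < n ] ∑[ l < n ] F (punchIn v i) (punchIn v j) (punchIn v l)

monoCount-deleteVertex : ∀ {k n} (c : Coloring k (3 + n)) →
  ∑[ v < 3 + n ] monoCount (deleteVertex c v) ≡ n * monoCount c
monoCount-deleteVertex {n = n} c =
  trans (sum-cong-≗ λ v → trans (monoCount≡∑ (deleteVertex c v))
           (sum-cong-≗ λ i → sum-cong-≗ λ j → sum-cong-≗ λ l → χ-deleteVertex c v i j l))
  (trans (sym (+-cancelˡ-≡ (S + (S + S)) _ _ (trans (e₁ S (n * S)) (trans key (e₂ S _)))))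
    (cong (n *_) (sym (monoCount≡∑ c))))
  where
  S = ∑[ i < 3 + n ] ∑[ j < 3 + n ] ∑[ l < 3 + n ] χ c i j l
  key = ∑³-punchIn (χ c)
    (λ i l → χ-no c i i l λ t → <-irrefl refl (proj₁ (proj₁ t)))
    (λ i j → χ-no c i j j λ t → <-irrefl refl (proj₂ (proj₁ t)))
    (λ i j → χ-no c i j i λ t → <-irrefl refl (<-trans (proj₁ (proj₁ t)) (proj₂ (proj₁ t))))
  e₁ : ∀ S T → S + (S + S) + T ≡ S + (S + (S + T))
  e₁ = solve-∀
  e₂ : ∀ S T → S + (S + (S + T)) ≡ S + (S + S) + T
  e₂ = solve-∀

-- A density argument with denominators cleared: the proportion of monochromatic triangles is the
-- average of the proportions in the vertex-deleted subgraphs, so a lower bound at N persists for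
-- larger n.
monoCount-averaging : ∀ {k} s N → 3 ≤ N → (∀ (c : Coloring k N) → Gallai c → s ≤ monoCount c) →
  ∀ {n} → N ≤′ n → (c : Coloring k n) → Gallai c →
  s * (n * (n ∸ 1) * (n ∸ 2)) ≤ monoCount c * (N * (N ∸ 1) * (N ∸ 2))
monoCount-averaging s N 3≤N base ≤′-refl c G = *-monoˡ-≤ (N * (N ∸ 1) * (N ∸ 2)) (base c G)
monoCount-averaging s N 3≤N base {suc n} (≤′-step N≤n) c G with ≤-trans 3≤N (≤′⇒≤ N≤n)
monoCount-averaging s N 3≤N base {suc (suc (suc (suc n)))} (≤′-step N≤n) c G | s≤s (s≤s (s≤s z≤n)) =
  -- On 4 + n vertices a given triangle survives `suc n` deletions. That there are at least four
  -- vertices comes from 3 ≤ N.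
  *-cancelˡ-≤ (suc n) (begin
    suc n * (s * ((4 + n) * (3 + n) * (2 + n)))                ≡⟨ e₁ n s ⟩
    (4 + n) * (s * ((3 + n) * (2 + n) * (1 + n)))              ≡⟨ sum-const (4 + n) (s * ((3 + n) * (2 + n) * (1 + n))) ⟨
    ∑[ v < 4 + n ] (s * ((3 + n) * (2 + n) * (1 + n)))
      ≤⟨ sum-mono-≤ (λ v → monoCount-averaging s N 3≤N base N≤n (deleteVertex c v) (deleteVertex-Gallai c v G)) ⟩
    ∑[ v < 4 + n ] (monoCount (deleteVertex c v) * D)          ≡⟨ sum-*ʳ (λ v → monoCount (deleteVertex c v)) D ⟩
    ∑[ v < 4 + n ] (monoCount (deleteVertex c v)) * D          ≡⟨ cong (_* D) (monoCount-deleteVertex c) ⟩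
    suc n * monoCount c * D                                    ≡⟨ *-assoc (suc n) (monoCount c) D ⟩
    suc n * (monoCount c * D)                                  ∎)
  where
  open ≤-Reasoning
  D = N * (N ∸ 1) * (N ∸ 2)
  e₁ : ∀ n s → suc n * (s * ((4 + n) * (3 + n) * (2 + n))) ≡ (4 + n) * (s * ((3 + n) * (2 + n) * (1 + n)))
  e₁ = solve-∀

-- Gallai's theorem

module _ {A : Set} where

  length-filter+length-filter-∁ : ∀ {P : Pred A 0ℓ} (P? : Decidable P) L →
    length L ≡ length (filter P? L) + length (filter (∁? P?) L)
  length-filter+length-filter-∁ P? [] = refl
  length-filter+length-filter-∁ P? (x ∷ L) with P? x
  ... | yes _ = cong suc (length-filter+length-filter-∁ P? L)
  ... | no _ = trans (cong suc (length-filter+length-filter-∁ P? L)) (sym (+-suc _ _))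

  filter-⊆ : ∀ {P : Pred A 0ℓ} (P? : Decidable P) L → filter P? L ⊆ L
  filter-⊆ P? L = proj₁ ∘ ∈-filter⁻ P?

  Unique-∈ : ∀ {x y : A} {L} → Unique (x ∷ L) → y ∈ L → x ≢ y
  Unique-∈ (x∉ ∷ _) y∈ = All.lookup x∉ y∈

  distinct₂ : ∀ (L : List A) → Unique L → 2 ≤ length L → ∃₂ λ x y → x ∈ L × y ∈ L × x ≢ y
  distinct₂ (x ∷ y ∷ L) U _ = x , y , here refl , there (here refl) , Unique-∈ U (here refl)
  distinct₂ (_ ∷ []) _ (s≤s ())

  distinct₃ : ∀ (L : List A) → Unique L → 3 ≤ length L →
    ∃ λ x → ∃₂ λ y z → x ∈ L × y ∈ L × z ∈ L × x ≢ y × x ≢ z × y ≢ z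
  distinct₃ (x ∷ y ∷ z ∷ L) U@(_ ∷ V) _ = x , y , z , here refl , there (here refl) , there (there (here refl)) ,
    Unique-∈ U (here refl) , Unique-∈ U (there (here refl)) , Unique-∈ V (here refl)
  distinct₃ (_ ∷ []) _ (s≤s ())
  distinct₃ (_ ∷ _ ∷ []) _ (s≤s (s≤s ()))

  module _ (_≟_ : DecidableEquality A) where

    remove : A → List A → List A
    remove u = filter (λ x → ¬? (x ≟ u))

    ∈-remove⁻ : ∀ u {L x} → x ∈ remove u L → x ∈ L × x ≢ u
    ∈-remove⁻ u = ∈-filter⁻ (λ x → ¬? (x ≟ u))

    remove-Unique : ∀ u {L} → Unique L → Unique (remove u L)
    remove-Unique u = Unique.filter⁺ (λ x → ¬? (x ≟ u))

    length-remove : ∀ u {L} → Unique L → length L ≤ suc (length (remove u L))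
    length-remove u {L} U = ≤-trans (≤-reflexive (length-filter+length-filter-∁ (_≟ u) L))
      (+-monoˡ-≤ _ (≮⇒≥ λ 2≤ → two 2≤))
      where
      two : ¬ (2 ≤ length (filter (_≟ u) L))
      two 2≤ with distinct₂ _ (Unique.filter⁺ (_≟ u) U) 2≤
      ... | x , y , x∈ , y∈ , x≢y =
        x≢y (trans (proj₂ (∈-filter⁻ (_≟ u) {xs = L} x∈)) (sym (proj₂ (∈-filter⁻ (_≟ u) {xs = L} y∈))))

    length-remove-∈ : ∀ {u} {L} → u ∈ L → length (remove u L) < length L
    length-remove-∈ {u} {L} u∈ = List.filter-notAll (λ x → ¬? (x ≟ u)) L (lose u∈ (λ u≢u → u≢u refl))

    distinct₃-avoiding : ∀ (L : List A) x y z → Unique L → 6 ≤ length L →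
      let Apart = λ v → v ∈ L × v ≢ x × v ≢ y × v ≢ z in
      ∃ λ v₁ → ∃₂ λ v₂ v₃ → Apart v₁ × Apart v₂ × Apart v₃ × v₁ ≢ v₂ × v₁ ≢ v₃ × v₂ ≢ v₃
    distinct₃-avoiding L x y z U 6≤ with distinct₃ _ U₃ 3≤
      where
      U₁ = remove-Unique x U
      U₂ = remove-Unique y U₁
      U₃ = remove-Unique z U₂
      3≤ : 3 ≤ length (remove z (remove y (remove x L)))
      3≤ = ≤-pred (≤-trans (≤-pred (≤-trans (≤-pred (≤-trans 6≤ (length-remove x U)))
        (length-remove y U₁))) (length-remove z U₂))
    ... | v₁ , v₂ , v₃ , v₁∈ , v₂∈ , v₃∈ , distinct =
      v₁ , v₂ , v₃ , apart v₁∈ , apart v₂∈ , apart v₃∈ , distinct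
      where
      apart : ∀ {v} → v ∈ remove z (remove y (remove x L)) → v ∈ L × v ≢ x × v ≢ y × v ≢ z
      apart v∈ with ∈-remove⁻ z {remove y (remove x L)} v∈
      ... | v∈′ , vz with ∈-remove⁻ y {remove x L} v∈′
      ...   | v∈″ , vy with ∈-remove⁻ x {L} v∈″
      ...     | v∈L , vx = v∈L , vx , vy , vz

  Unique-map⁻ : ∀ {f : A → A} {L} → Unique (map f L) → ∀ {x y} → x ∈ L → y ∈ L → x ≢ y → f x ≢ f y
  Unique-map⁻ U (here refl) (here refl) x≢y _ = x≢y refl
  Unique-map⁻ (p ∷ U) (here refl) (there y∈) x≢y = All.lookup (All.map⁻ p) y∈
  Unique-map⁻ (p ∷ U) (there x∈) (here refl) x≢y = All.lookup (All.map⁻ p) x∈ ∘ sym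
  Unique-map⁻ (p ∷ U) (there x∈) (there y∈) x≢y = Unique-map⁻ U x∈ y∈ x≢y

  LargeFibre : (A → A) → ℕ → List A → Set
  LargeFibre f j L =
    ∃ λ M → M ⊆ L × Unique M × (∀ {x y} → x ∈ M → y ∈ M → f x ≡ f y) × length L ≤ j * length M

  -- Pigeonhole. The number of values of f is bounded through lists with pairwise distinct images
  -- because Goodman's theorem will be applied to such a list of representatives. Outside the fibre
  -- of x these lists are shorter by one, as x could be added; the larger of this fibre and the one
  -- found outside it is kept.
  large-fibre : DecidableEquality A → (f : A → A) → ∀ j L → Unique L →
    (∀ R → R ⊆ L → Unique (map f R) → length R ≤ j) → LargeFibre f j L
  large-fibre _≟_ f j [] U bound = [] , id , [] , (λ ()) , z≤n
  large-fibre _≟_ f zero (x ∷ L) U bound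
    with bound (x ∷ []) (λ { (here refl) → here refl }) ([] ∷ [])
  ... | ()
  large-fibre _≟_ f (suc j) L@(x ∷ _) U bound
    with large-fibre _≟_ f j (filter (∁? (λ y → f x ≟ f y)) L) (Unique.filter⁺ (∁? (λ y → f x ≟ f y)) U) bound′
    where
    bound′ : ∀ R → R ⊆ filter (∁? (λ y → f x ≟ f y)) L → Unique (map f R) → length R ≤ j
    bound′ R R⊆ V = ≤-pred (bound (x ∷ R)
      (λ { (here refl) → here refl ; (there y∈) → filter-⊆ (∁? (λ y → f x ≟ f y)) L (R⊆ y∈) })
      (All.map⁺ (All.tabulate λ y∈ → proj₂ (∈-filter⁻ (∁? (λ y → f x ≟ f y)) {xs = L} (R⊆ y∈))) ∷ V))
  ... | M , M⊆ , UM , fM , len = choose (≤-total (length F) (length M))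
    where
    F = filter (λ y → f x ≟ f y) L
    len′ : length L ≤ length F + j * length M
    len′ = ≤-trans (≤-reflexive (length-filter+length-filter-∁ (λ y → f x ≟ f y) L)) (+-monoʳ-≤ (length F) len)
    F⁻ : ∀ {y} → y ∈ F → f x ≡ f y
    F⁻ = proj₂ ∘ ∈-filter⁻ (λ y → f x ≟ f y) {xs = L}
    choose : length F ≤ length M ⊎ length M ≤ length F → LargeFibre f (suc j) L
    choose (inj₁ F≤M) = M , (λ y∈ → filter-⊆ (∁? (λ y → f x ≟ f y)) L (M⊆ y∈)) , UM , fM , ≤-trans len′ (+-monoˡ-≤ _ F≤M)
    choose (inj₂ M≤F) = F , filter-⊆ (λ y → f x ≟ f y) L , Unique.filter⁺ (λ y → f x ≟ f y) U ,
      (λ y∈ z∈ → trans (sym (F⁻ y∈)) (F⁻ z∈)) , ≤-trans len′ (+-monoʳ-≤ (length F) (*-monoʳ-≤ j M≤F))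

module GallaiColored {A K : Set} (_≟_ : DecidableEquality A) (_≟ᶜ_ : DecidableEquality K)
  (c : A → A → K) (c-sym : ∀ x y → c x y ≡ c y x)
  (nonRainbow : ∀ x y z → c x y ≡ c x z ⊎ c x y ≡ c y z ⊎ c x z ≡ c y z) where

  Between : K → K → A → A → Set
  Between p q x y = c x y ≡ p ⊎ c x y ≡ q

  between? : ∀ p q x y → Dec (Between p q x y)
  between? p q x y = (c x y ≟ᶜ p) ⊎-dec (c x y ≟ᶜ q)

  Between-sym : ∀ {p q} x y → Between p q x y → Between p q y x
  Between-sym {p} {q} x y = subst (λ r → r ≡ p ⊎ r ≡ q) (c-sym x y)

  module _ {p q : K} where

    -- A colour in the pair p, q never equals one outside it, so the coincidence granted by
    -- `nonRainbow` can only be between the two edges at x.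
    ¬Between-≡ : ∀ {x y z} → ¬ Between p q x y → ¬ Between p q x z → Between p q y z → c x y ≡ c x z
    ¬Between-≡ {x} {y} {z} ¬xy ¬xz yz with nonRainbow x y z
    ... | inj₁ e = e
    ... | inj₂ (inj₁ e) = ⊥-elim (¬xy (subst (λ r → r ≡ p ⊎ r ≡ q) (sym e) yz))
    ... | inj₂ (inj₂ e) = ⊥-elim (¬xz (subst (λ r → r ≡ p ⊎ r ≡ q) (sym e) yz))

    Between-≡ : ∀ {x y z} → Between p q x y → Between p q y z → ¬ Between p q x z → c y x ≡ c y z
    Between-≡ {x} {y} {z} xy yz ¬xz with nonRainbow x y z
    ... | inj₁ e = ⊥-elim (¬xz (subst (λ r → r ≡ p ⊎ r ≡ q) e xy))
    ... | inj₂ (inj₁ e) = trans (c-sym y x) e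
    ... | inj₂ (inj₂ e) = ⊥-elim (¬xz (subst (λ r → r ≡ p ⊎ r ≡ q) (sym e) yz))

  module Components (p q : K) where

    -- Components grow by one vertex v at a time, with f the component map so far. The new vertex
    -- absorbs each old component into which it sends an edge of a third colour, and becomes the
    -- representative of the result.
    Touched : (A → A) → A → List A → A → Set
    Touched f v L x = Any (λ z → f z ≡ f x × ¬ Between p q v z) L

    Merged : (A → A) → A → List A → A → Set
    Merged f v L x = x ≡ v ⊎ Touched f v L x

    merged? : ∀ f v L x → Dec (Merged f v L x)
    merged? f v L x = (x ≟ v) ⊎-dec any? (λ z → (f z ≟ f x) ×-dec ¬? (between? p q v z)) L

    -- Two vertices of L have the same component iff they are joined inside L by
    -- edges coloured neither p nor q.
    component : List A → A → A
    component [] x = x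
    component (v ∷ L) x = if does (merged? (component L) v L x) then v else component L x

    component-merged : ∀ {v L x} → Merged (component L) v L x → component (v ∷ L) x ≡ v
    component-merged {v} {L} {x} m =
      cong (if_then v else component L x) (dec-true (merged? (component L) v L x) m)

    component-unmerged : ∀ {v L x} → ¬ Merged (component L) v L x → component (v ∷ L) x ≡ component L x
    component-unmerged {v} {L} {x} ¬m =
      cong (if_then v else component L x) (dec-false (merged? (component L) v L x) ¬m)

    unmerged-∈ : ∀ {v L x} → ¬ Merged (component L) v L x → x ∈ v ∷ L → x ∈ L
    unmerged-∈ ¬m (here x≡v) = ⊥-elim (¬m (inj₁ x≡v))
    unmerged-∈ ¬m (there x∈) = x∈

    component-∈ : ∀ {L x} → x ∈ L → component L x ∈ L
    component-∈ {v ∷ L} {x} x∈ with merged? (component L) v L x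
    ... | yes m = here (component-merged m)
    ... | no ¬m = there (subst (_∈ L) (sym (component-unmerged ¬m)) (component-∈ (unmerged-∈ ¬m x∈)))

    component-≢ : ∀ {v L x} → Unique (v ∷ L) → x ∈ L → component L x ≢ v
    component-≢ U x∈ e = Unique-∈ U (component-∈ x∈) (sym e)

    merged-unmerged : ∀ {v L x y} → Unique (v ∷ L) → Merged (component L) v L x → ¬ Merged (component L) v L y →
      x ∈ v ∷ L → y ∈ L → (∀ {x y} → x ∈ L → y ∈ L → component L x ≢ component L y → Between p q x y) →
      Between p q x y
    merged-unmerged {v} {L} {x} {y} U m ¬m x∈ y∈ IH with x ≟ v
    ... | yes refl with between? p q x y
    ...   | yes b = b
    ...   | no ¬b = ⊥-elim (¬m (inj₂ (lose y∈ (refl , ¬b))))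
    merged-unmerged {v} {L} {x} {y} U m ¬m x∈ y∈ IH | no x≢v with m | x∈
    ... | inj₁ x≡v | _ = ⊥-elim (x≢v x≡v)
    ... | inj₂ t | here x≡v = ⊥-elim (x≢v x≡v)
    ... | inj₂ t | there x∈L with find t
    ...   | z , z∈ , fz≡fx , ¬b =
      IH x∈L y∈ λ fx≡fy → ¬m (inj₂ (lose z∈ (trans fz≡fx fx≡fy , ¬b)))

    component-cross : ∀ {L} → Unique L → ∀ {x y} → x ∈ L → y ∈ L → component L x ≢ component L y → Between p q x y
    component-cross {v ∷ L} U@(_ ∷ V) {x} {y} x∈ y∈ fx≢fy
      with merged? (component L) v L x | merged? (component L) v L y
    ... | yes mx | yes my = ⊥-elim (fx≢fy (trans (component-merged mx) (sym (component-merged my))))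
    ... | yes mx | no ¬my = merged-unmerged U mx ¬my x∈ (unmerged-∈ ¬my y∈) (component-cross V)
    ... | no ¬mx | yes my = Between-sym y x (merged-unmerged U my ¬mx y∈ (unmerged-∈ ¬mx x∈) (component-cross V))
    ... | no ¬mx | no ¬my = component-cross V (unmerged-∈ ¬mx x∈) (unmerged-∈ ¬my y∈)
      λ e → fx≢fy (trans (component-unmerged ¬mx) (trans e (sym (component-unmerged ¬my))))

    -- Along an edge coloured neither p nor q the colour seen from y cannot change, by `Between-≡`,
    -- and such edges connect the component. Recursion on L replaces paths: an old component
    -- absorbed by v is homogeneous already and contains some w with vw of a third colour, so y sees
    -- it as it sees v. The vertex y is not tied to the list, which may shrink past it.
    component-homogeneous : ∀ {L} → Unique L → ∀ y i →
      (∀ {x} → x ∈ L → component L x ≡ i → Between p q y x) →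
      ∀ {x x′} → x ∈ L → x′ ∈ L → component L x ≡ i → component L x′ ≡ i → c y x ≡ c y x′
    component-homogeneous {v ∷ L} U@(_ ∷ V) y i b {x} {x′} x∈ x′∈ fx≡i fx′≡i = cases (merged? f v L x) (merged? f v L x′)
      where
      f = component L
      b′ : ∀ {z} → Merged f v L z → z ∈ v ∷ L → i ≡ v → Between p q y z
      b′ m z∈ i≡v = b z∈ (trans (component-merged m) (sym i≡v))
      to-v : ∀ {z} → Merged f v L z → z ∈ v ∷ L → i ≡ v → c y z ≡ c y v
      to-v (inj₁ refl) z∈ i≡v = refl
      to-v {z} (inj₂ t) (here refl) i≡v = refl
      to-v {z} (inj₂ t) (there z∈) i≡v with find t
      ... | w , w∈ , fw≡fz , ¬b = trans
        (component-homogeneous V y (f z) (λ {u} u∈ fu≡fz → b′ (inj₂ (lose w∈ (trans fw≡fz (sym fu≡fz) , ¬b))) (there u∈) i≡v)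
          z∈ w∈ refl fw≡fz)
        (sym (Between-≡ (Between-sym y v (b′ (inj₁ refl) (here refl) i≡v)) (b′ (inj₂ (lose w∈ (refl , ¬b))) (there w∈) i≡v) ¬b))
      i≡v : ∀ {z} → Merged f v L z → component (v ∷ L) z ≡ i → i ≡ v
      i≡v m fz≡i = trans (sym fz≡i) (component-merged m)
      i≢v : ∀ {z} → ¬ Merged f v L z → z ∈ v ∷ L → component (v ∷ L) z ≡ i → i ≢ v
      i≢v ¬m z∈ fz≡i i≡v = component-≢ U (unmerged-∈ ¬m z∈) (trans (sym (component-unmerged ¬m)) (trans fz≡i i≡v))
      cases : Dec (Merged f v L x) → Dec (Merged f v L x′) → c y x ≡ c y x′
      cases (yes m) (yes m′) = trans (to-v m x∈ (i≡v m fx≡i)) (sym (to-v m′ x′∈ (i≡v m fx≡i)))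
      cases (yes m) (no ¬m′) = ⊥-elim (i≢v ¬m′ x′∈ fx′≡i (i≡v m fx≡i))
      cases (no ¬m) (yes m′) = ⊥-elim (i≢v ¬m x∈ fx≡i (i≡v m′ fx′≡i))
      cases (no ¬m) (no ¬m′) = component-homogeneous V y i
        (λ {u} u∈ fu≡i → b (there u∈) (trans (component-unmerged (¬mu u∈ fu≡i)) fu≡i))
        (unmerged-∈ ¬m x∈) (unmerged-∈ ¬m′ x′∈)
        (trans (sym (component-unmerged ¬m)) fx≡i) (trans (sym (component-unmerged ¬m′)) fx′≡i)
        where
        ¬mu : ∀ {u} → u ∈ L → f u ≡ i → ¬ Merged f v L u
        ¬mu u∈ fu≡i (inj₁ refl) = Unique-∈ U u∈ refl
        ¬mu u∈ fu≡i (inj₂ t) with find t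
        ... | w , w∈ , fw≡fu , ¬b =
          ¬m (inj₂ (lose w∈ (trans fw≡fu (trans fu≡i (trans (sym fx≡i) (component-unmerged ¬m))) , ¬b)))

  open Components

  component-module : ∀ p q {L} → Unique L → ∀ {x x′ y} → x ∈ L → x′ ∈ L → y ∈ L →
    component p q L x ≡ component p q L x′ → component p q L x ≢ component p q L y → c x y ≡ c x′ y
  component-module p q {L} U {x} {x′} {y} x∈ x′∈ y∈ fx≡fx′ fx≢fy =
    trans (c-sym x y) (trans (component-homogeneous p q U y (component p q L x)
      (λ z∈ fz≡fx → component-cross p q U y∈ z∈ λ fy≡fz → fx≢fy (sym (trans fy≡fz fz≡fx)))
      x∈ x′∈ refl (sym fx≡fx′)) (c-sym y x′))

  Disconnected : List A → Set
  Disconnected L = ∃₂ λ p q → ∃₂ λ x y → x ∈ L × y ∈ L × component p q L x ≢ component p q L y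

  -- No third colour leaves v, so v stays a component by itself.
  disconnected-at : ∀ {p q v L} → Unique (v ∷ L) → 1 ≤ length L →
    (∀ {x} → x ∈ L → Between p q v x) → Disconnected (v ∷ L)
  disconnected-at {p} {q} {v} {L = L@(a ∷ _)} U _ b =
    p , q , v , a , here refl , there (here refl) , λ e →
      component-≢ p q U (here refl) (trans (sym (component-unmerged p q ¬m))
        (trans (sym e) (component-merged p q {v} {L} {v} (inj₁ refl))))
    where
    ¬m : ¬ Merged p q (component p q L) v L a
    ¬m (inj₁ a≡v) = Unique-∈ U (here refl) (sym a≡v)
    ¬m (inj₂ t) with find t
    ... | z , z∈ , _ , ¬b = ¬b (b z∈)

  module _ {p q v L} (U : Unique (v ∷ L)) {x₀ y₀} (x₀∈ : x₀ ∈ L) (y₀∈ : y₀ ∈ L)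
    (fx₀≢fy₀ : component p q L x₀ ≢ component p q L y₀)
    (touched : ∀ {x} → x ∈ L → ∃ λ w → w ∈ L × component p q L w ≡ component p q L x × ¬ Between p q v w) where

    private
      f : A → A
      f = component p q L

      UL : Unique L
      UL = AllPairs.tail U

      elsewhere : ∀ {x} → x ∈ L → ∃ λ w → w ∈ L × f x ≢ f w × ¬ Between p q v w
      elsewhere {x} x∈ with f x ≟ f x₀
      ... | yes fx≡fx₀ with touched y₀∈
      ...   | w , w∈ , fw≡fy₀ , ¬b = w , w∈ , (λ fx≡fw → fx₀≢fy₀ (trans (sym fx≡fx₀) (trans fx≡fw fw≡fy₀))) , ¬b
      elsewhere {x} x∈ | no fx≢fx₀ with touched x₀∈
      ...   | w , w∈ , fw≡fx₀ , ¬b = w , w∈ , (λ fx≡fw → fx≢fx₀ (trans fx≡fw fw≡fx₀)) , ¬b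

    -- Edges of a third colour from v into different components agree, as the edge joining their
    -- ends is coloured p or q. Two that enter the same component are both compared with one that
    -- enters another.
    third-color-unique : ∀ {x y} → x ∈ L → y ∈ L → ¬ Between p q v x → ¬ Between p q v y → c v x ≡ c v y
    third-color-unique {x} {y} x∈ y∈ ¬x ¬y with f x ≟ f y
    ... | no fx≢fy = ¬Between-≡ ¬x ¬y (component-cross p q UL x∈ y∈ fx≢fy)
    ... | yes fx≡fy with elsewhere x∈
    ...   | w , w∈ , fx≢fw , ¬w = trans
      (¬Between-≡ ¬x ¬w (component-cross p q UL x∈ w∈ fx≢fw))
      (sym (¬Between-≡ ¬y ¬w (component-cross p q UL y∈ w∈ (fx≢fw ∘ trans fx≡fy))))

    -- In the triangle v, x, w only the edge vw has a third colour, so the other two edges agree.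
    attached : ∀ {x w} → x ∈ L → w ∈ L → f x ≢ f w → Between p q v x → ¬ Between p q v w → c v x ≡ c x w
    attached {x} x∈ w∈ fx≢fw b ¬b = trans (c-sym v x) (Between-≡ b (component-cross p q UL x∈ w∈ fx≢fw) ¬b)

    -- If x and y share a component, take w elsewhere with vw of a third colour: vy, yw, xw, vx have
    -- equal colours. Otherwise take such w in the component of x and w′ in that of y: now vy, yw,
    -- yx, xw′, vx have equal colours.
    not-both-colors : ∀ {x y} → x ∈ L → y ∈ L → c v x ≡ q → c v y ≡ p → p ≡ q
    not-both-colors {x} {y} x∈ y∈ vx≡q vy≡p with f x ≟ f y
    ... | yes fx≡fy with elsewhere x∈
    ...   | w , w∈ , fx≢fw , ¬w = begin
      p      ≡⟨ vy≡p ⟨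
      c v y  ≡⟨ attached y∈ w∈ (fx≢fw ∘ trans fx≡fy) (inj₁ vy≡p) ¬w ⟩
      c y w  ≡⟨ component-module p q UL x∈ y∈ w∈ fx≡fy fx≢fw ⟨
      c x w  ≡⟨ attached x∈ w∈ fx≢fw (inj₂ vx≡q) ¬w ⟨
      c v x  ≡⟨ vx≡q ⟩
      q      ∎
      where open ≡-Reasoning
    not-both-colors {x} {y} x∈ y∈ vx≡q vy≡p | no fx≢fy with touched x∈ | touched y∈
    ... | w , w∈ , fw≡fx , ¬w | w′ , w′∈ , fw′≡fy , ¬w′ = begin
      p       ≡⟨ vy≡p ⟨
      c v y   ≡⟨ attached y∈ w∈ (λ e → fx≢fy (sym (trans e fw≡fx))) (inj₁ vy≡p) ¬w ⟩
      c y w   ≡⟨ c-sym y w ⟩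
      c w y   ≡⟨ component-module p q UL w∈ x∈ y∈ fw≡fx (λ e → fx≢fy (trans (sym fw≡fx) e)) ⟩
      c x y   ≡⟨ c-sym x y ⟩
      c y x   ≡⟨ component-module p q UL w′∈ y∈ x∈ fw′≡fy (λ e → fx≢fy (sym (trans (sym fw′≡fy) e))) ⟨
      c w′ x  ≡⟨ c-sym w′ x ⟩
      c x w′  ≡⟨ attached x∈ w′∈ (λ e → fx≢fy (trans e fw′≡fy)) (inj₂ vx≡q) ¬w′ ⟨
      c v x   ≡⟨ vx≡q ⟩
      q       ∎
      where open ≡-Reasoning

    -- If v reaches every component by a third colour, then that colour is unique and v does not
    -- send out both p and q, so the edges at v have only two colours.
    disconnected-touched : Disconnected (v ∷ L)
    disconnected-touched with touched x₀∈ | any? (λ x → c v x ≟ᶜ q) L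
    ... | w , w∈ , _ , ¬w | no ¬q = disconnected-at {p} {c v w} U (∈-length w∈) b
      where
      b : ∀ {x} → x ∈ L → Between p (c v w) v x
      b {x} x∈ with between? p q v x
      ... | yes (inj₁ e) = inj₁ e
      ... | yes (inj₂ e) = ⊥-elim (¬q (lose x∈ e))
      ... | no ¬b = inj₂ (third-color-unique x∈ w∈ ¬b ¬w)
    ... | w , w∈ , _ , ¬w | yes ∃q with find ∃q
    ...   | y , y∈ , vy≡q = disconnected-at {q} {c v w} U (∈-length w∈) b
      where
      b : ∀ {x} → x ∈ L → Between q (c v w) v x
      b {x} x∈ with between? p q v x
      ... | yes (inj₁ e) = inj₁ (trans e (not-both-colors y∈ x∈ vy≡q e))
      ... | yes (inj₂ e) = inj₁ e
      ... | no ¬b = inj₂ (third-color-unique x∈ w∈ ¬b ¬w)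

  -- Induction on the vertices. A component of L that v does not reach by a third colour stays apart
  -- from v for the same p and q. If v reaches all of them, a new pair of colours isolates v.
  gallai-disconnected : ∀ L → Unique L → 2 ≤ length L → Disconnected L
  gallai-disconnected (_ ∷ []) _ (s≤s ())
  -- A single edge offers only one colour; p and q may coincide.
  gallai-disconnected (v ∷ a ∷ []) U _ =
    disconnected-at {c v a} {c v a} U (s≤s z≤n) λ { (here refl) → inj₁ refl }
  gallai-disconnected (v ∷ L@(_ ∷ _ ∷ _)) U@(_ ∷ V) _ with gallai-disconnected L V (s≤s (s≤s z≤n))
  ... | p , q , x , y , x∈ , y∈ , fx≢fy with all? (λ z → merged? p q (component p q L) v L z) L
  ...   | no ¬all with find (All.¬All⇒Any¬ (λ z → merged? p q (component p q L) v L z) L ¬all)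
  ...     | z , z∈ , ¬m = p , q , z , v , there z∈ , here refl , λ e → component-≢ p q U z∈
    (trans (sym (component-unmerged p q ¬m)) (trans e (component-merged p q {v} {L} {v} (inj₁ refl))))
  gallai-disconnected (v ∷ L@(_ ∷ _ ∷ _)) U@(_ ∷ V) _ | p , q , x , y , x∈ , y∈ , fx≢fy | yes all =
    disconnected-touched U x∈ y∈ fx≢fy touched
    where
    touched : ∀ {z} → z ∈ L → ∃ λ w → w ∈ L × component p q L w ≡ component p q L z × ¬ Between p q v w
    touched z∈ with All.lookup all z∈
    ... | inj₁ refl = ⊥-elim (Unique-∈ U z∈ refl)
    ... | inj₂ t with find t
    ...   | w , w∈ , e , ¬b = w , w∈ , e , ¬b

-- Decomposition of colourings with at most one monochromatic triangle

module TriangleBounds {A K : Set} (_≟_ : DecidableEquality A) (_≟ᶜ_ : DecidableEquality K)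
  (c : A → A → K) (c-sym : ∀ x y → c x y ≡ c y x)
  (nonRainbow : ∀ x y z → c x y ≡ c x z ⊎ c x y ≡ c y z ⊎ c x z ≡ c y z) where

  open GallaiColored _≟_ _≟ᶜ_ c c-sym nonRainbow

  Mono₃ : A → A → A → Set
  Mono₃ x y z = x ≢ y × x ≢ z × y ≢ z × c x y ≡ c x z × c x y ≡ c y z

  mono₃? : ∀ x y z → Dec (Mono₃ x y z)
  mono₃? x y z = ¬? (x ≟ y) ×-dec ¬? (x ≟ z) ×-dec ¬? (y ≟ z) ×-dec (c x y ≟ᶜ c x z) ×-dec (c x y ≟ᶜ c y z)

  Mono₃-swap : ∀ {x y z} → Mono₃ x y z → Mono₃ y x z
  Mono₃-swap {x} {y} (xy , xz , yz , e , e′) = xy ∘ sym , yz , xz , trans (c-sym y x) e′ , trans (c-sym y x) e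

  Mono₃-rotate : ∀ {x y z} → Mono₃ x y z → Mono₃ y z x
  Mono₃-rotate {x} {y} {z} (xy , xz , yz , e , e′) =
    yz , xy ∘ sym , xz ∘ sym , trans (sym e′) (c-sym x y) , trans (sym e′) (trans e (c-sym x z))

  -- Containment of the first vertex x′ is enough: `Mono₃` is invariant under permutations, so the
  -- same condition applies to y′ and z′.
  AtMostOne : List A → Set
  AtMostOne L = ∀ {x y z x′ y′ z′} → x ∈ L → y ∈ L → z ∈ L → x′ ∈ L → y′ ∈ L → z′ ∈ L →
    Mono₃ x y z → Mono₃ x′ y′ z′ → x′ ∈ x ∷ y ∷ z ∷ []

  TriangleFree : List A → Set
  TriangleFree L = ∀ {x y z} → x ∈ L → y ∈ L → z ∈ L → ¬ Mono₃ x y z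

  Avoids : K → List A → Set
  Avoids r L = ∀ {x y} → x ∈ L → y ∈ L → x ≢ y → c x y ≢ r

  Occurs : K → List A → Set
  Occurs r L = ∃₂ λ x y → x ∈ L × y ∈ L × x ≢ y × c x y ≡ r

  Colors : List K → List A → Set
  Colors S L = ∀ {x y} → x ∈ L → y ∈ L → x ≢ y → c x y ∈ S

  AtMostOne-⊆ : ∀ {L M} → M ⊆ L → AtMostOne L → AtMostOne M
  AtMostOne-⊆ s one x y z x′ y′ z′ = one (s x) (s y) (s z) (s x′) (s y′) (s z′)

  TriangleFree-⊆ : ∀ {L M} → M ⊆ L → TriangleFree L → TriangleFree M
  TriangleFree-⊆ s tf x y z = tf (s x) (s y) (s z)

  Colors-⊆ : ∀ {S L M} → M ⊆ L → Colors S L → Colors S M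
  Colors-⊆ s col x y = col (s x) (s y)

  TriangleFree⇒AtMostOne : ∀ {L} → TriangleFree L → AtMostOne L
  TriangleFree⇒AtMostOne tf x y z x′ y′ z′ m m′ = ⊥-elim (tf x y z m)

  three-equal : ∀ {p q v} M → Unique M → 5 ≤ length M → (∀ {x} → x ∈ M → Between p q v x) →
    ∃ λ x → ∃₂ λ y z → x ∈ M × y ∈ M × z ∈ M × x ≢ y × x ≢ z × y ≢ z × c v x ≡ c v y × c v x ≡ c v z
  three-equal {p} {q} {v} M U 5≤ b = choose (3 ≤? length P) (3 ≤? length Q)
    where
    P = filter (λ x → c v x ≟ᶜ p) M
    Q = filter (∁? (λ x → c v x ≟ᶜ p)) M
    vP : ∀ {x} → x ∈ P → c v x ≡ p
    vP x∈ = proj₂ (∈-filter⁻ (λ x → c v x ≟ᶜ p) {xs = M} x∈)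
    vQ : ∀ {x} → x ∈ Q → c v x ≡ q
    vQ x∈ with ∈-filter⁻ (∁? (λ x → c v x ≟ᶜ p)) {xs = M} x∈
    ... | x∈M , ¬p = [ ⊥-elim ∘ ¬p , id ]′ (b x∈M)
    Goal = ∃ λ x → ∃₂ λ y z → x ∈ M × y ∈ M × z ∈ M × x ≢ y × x ≢ z × y ≢ z × c v x ≡ c v y × c v x ≡ c v z
    within : ∀ {N r} → N ⊆ M → Unique N → (∀ {x} → x ∈ N → c v x ≡ r) → 3 ≤ length N → Goal
    within {N} N⊆ UN vN 3≤ with distinct₃ N UN 3≤
    ... | x , y , z , x∈ , y∈ , z∈ , xy , xz , yz =
      x , y , z , N⊆ x∈ , N⊆ y∈ , N⊆ z∈ , xy , xz , yz , trans (vN x∈) (sym (vN y∈)) , trans (vN x∈) (sym (vN z∈))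
    choose : Dec (3 ≤ length P) → Dec (3 ≤ length Q) → Goal
    choose (yes 3≤) _ = within (filter-⊆ _ M) (Unique.filter⁺ (λ x → c v x ≟ᶜ p) U) vP 3≤
    choose (no _) (yes 3≤) = within (filter-⊆ _ M) (Unique.filter⁺ (∁? (λ x → c v x ≟ᶜ p)) U) vQ 3≤
    choose (no P≱3) (no Q≱3) = ⊥-elim (<⇒≱ (s≤s (≤-trans
      (≤-reflexive (length-filter+length-filter-∁ (λ x → c v x ≟ᶜ p) M))
      (+-mono-≤ (≤-pred (≰⇒> P≱3)) (≤-pred (≰⇒> Q≱3))))) 5≤)

  -- Goodman's theorem. A vertex in no triangle sees some three vertices in one colour, and these
  -- form the triangle T. So the three vertices off T send one and the same colour to T; they avoid
  -- that colour among themselves and thus form a second triangle.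
  module _ {p q L} (U : Unique L) (6≤ : 6 ≤ length L)
    (b : ∀ {x y} → x ∈ L → y ∈ L → x ≢ y → Between p q x y) (one : AtMostOne L) where

    private
      Outside : A → Set
      Outside v = ∀ {y z} → y ∈ L → z ∈ L → ¬ Mono₃ v y z

      two-colors : ∀ {u v u′ v′ w w′} → u ∈ L → v ∈ L → u′ ∈ L → v′ ∈ L → w ∈ L → w′ ∈ L →
        u ≢ v → u′ ≢ v′ → w ≢ w′ →
        c u v ≢ c w w′ → c u′ v′ ≢ c w w′ → c u v ≡ c u′ v′
      two-colors u v u′ v′ w w′ uv uv′ ww′ ¬e ¬e′ with b w w′ ww′ | b u v uv | b u′ v′ uv′
      ... | inj₁ f | inj₁ g | _      = ⊥-elim (¬e (trans g (sym f)))
      ... | inj₂ f | inj₂ g | _      = ⊥-elim (¬e (trans g (sym f)))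
      ... | inj₁ f | _      | inj₁ g = ⊥-elim (¬e′ (trans g (sym f)))
      ... | inj₂ f | _      | inj₂ g = ⊥-elim (¬e′ (trans g (sym f)))
      ... | inj₁ _ | inj₂ g | inj₂ h = trans g (sym h)
      ... | inj₂ _ | inj₁ g | inj₁ h = trans g (sym h)

      outside-triangle : ∀ {v} → v ∈ L → Outside v → ∃ λ x → ∃₂ λ y z →
        x ∈ L × y ∈ L × z ∈ L × v ≢ x × v ≢ y × v ≢ z ×
        Mono₃ x y z × c v x ≡ c v y × c v x ≡ c v z × c v x ≢ c x y
      outside-triangle {v} v∈ out
        with three-equal {p} {q} {v} (remove _≟_ v L) (remove-Unique _≟_ v U)
               (≤-pred (≤-trans 6≤ (length-remove _≟_ v U)))
               (λ x∈ → b v∈ (proj₁ (∈-remove⁻ _≟_ v x∈)) (proj₂ (∈-remove⁻ _≟_ v {L} x∈) ∘ sym))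
      ... | x , y , z , x∈ , y∈ , z∈ , xy , xz , yz , exy , exz =
        x , y , z , x∈L , y∈L , z∈L , vx , vy , vz ,
        (xy , xz , yz , other x∈L y∈L x∈L z∈L xy xz ¬xy ¬xz , other x∈L y∈L y∈L z∈L xy yz ¬xy ¬yz) , exy , exz , ¬xy
        where
        x∈L = proj₁ (∈-remove⁻ _≟_ v x∈)
        y∈L = proj₁ (∈-remove⁻ _≟_ v y∈)
        z∈L = proj₁ (∈-remove⁻ _≟_ v z∈)
        vx = proj₂ (∈-remove⁻ _≟_ v {L} x∈) ∘ sym
        vy = proj₂ (∈-remove⁻ _≟_ v {L} y∈) ∘ sym
        vz = proj₂ (∈-remove⁻ _≟_ v {L} z∈) ∘ sym
        ¬xy : c v x ≢ c x y
        ¬xy e = out x∈L y∈L (vx , vy , xy , exy , e)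
        ¬xz : c v x ≢ c x z
        ¬xz e = out x∈L z∈L (vx , vz , xz , exz , e)
        ¬yz : c v x ≢ c y z
        ¬yz e = out y∈L z∈L (vy , vz , yz , trans (sym exy) exz , trans (sym exy) e)
        other : ∀ {s t s′ t′} → s ∈ L → t ∈ L → s′ ∈ L → t′ ∈ L → s ≢ t → s′ ≢ t′ →
          c v x ≢ c s t → c v x ≢ c s′ t′ → c s t ≡ c s′ t′
        other s∈ t∈ s′∈ t′∈ st st′ ¬e ¬e′ =
          two-colors s∈ t∈ s′∈ t′∈ v∈ x∈L st st′ vx (¬e ∘ sym) (¬e′ ∘ sym)

      module _ {x y z} (x∈ : x ∈ L) (y∈ : y ∈ L) (z∈ : z ∈ L) (m : Mono₃ x y z) where

        Apart : A → Set
        Apart v = v ∈ L × v ≢ x × v ≢ y × v ≢ z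

        apart-outside : ∀ {v} → Apart v → Outside v
        apart-outside (v∈ , vx , vy , vz) s∈ t∈ m′ with one x∈ y∈ z∈ v∈ s∈ t∈ m m′
        ... | here e = vx e
        ... | there (here e) = vy e
        ... | there (there (here e)) = vz e

        -- The triangle that `outside-triangle` finds from v can only be xyz, and v sees all of it
        -- in one colour.
        apart-color : ∀ {v} → Apart v → c v x ≡ c v y
        apart-color {v} a@(v∈ , _) with outside-triangle v∈ (apart-outside a)
        ... | s , t , u , s∈ , t∈ , u∈ , _ , _ , _ , m′ , est , esu , _ =
          trans (to (one s∈ t∈ u∈ x∈ y∈ z∈ m′ m)) (sym (to (one s∈ t∈ u∈ y∈ x∈ z∈ m′ (Mono₃-swap m))))
          where
          to : ∀ {a} → a ∈ s ∷ t ∷ u ∷ [] → c v a ≡ c v s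
          to (here refl) = refl
          to (there (here refl)) = sym est
          to (there (there (here refl))) = sym esu

        apart-color-≢ : ∀ {v} → Apart v → c v x ≢ c x y
        apart-color-≢ a@(_ , vx , vy , _) e = apart-outside a x∈ y∈ (vx , vy , proj₁ m , apart-color a , e)

        apart-edge : ∀ {v v′} → Apart v → Apart v′ → v ≢ v′ → c v v′ ≡ c x y
        apart-edge {v} {v′} a@(v∈ , vx , _) a′@(v′∈ , v′x , _) vv′ =
          two-colors v∈ v′∈ x∈ y∈ v∈ x∈ vv′ (proj₁ m) vx
            (λ e → apart-outside a v′∈ x∈ (vv′ , vx , v′x , e , trans e same)) (apart-color-≢ a ∘ sym)
          where
          same : c v x ≡ c v′ x
          same = two-colors v∈ x∈ v′∈ x∈ x∈ y∈ vx v′x (proj₁ m) (apart-color-≢ a) (apart-color-≢ a′)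

        no-triangle : ⊥
        no-triangle with distinct₃-avoiding _≟_ L x y z U 6≤
        ... | v₁ , v₂ , v₃ , a₁ , a₂ , a₃ , v₁₂ , v₁₃ , v₂₃ =
          apart-outside a₁ (proj₁ a₂) (proj₁ a₃) (v₁₂ , v₁₃ , v₂₃ ,
            trans e₁₂ (sym (apart-edge a₁ a₃ v₁₃)) , trans e₁₂ (sym (apart-edge a₂ a₃ v₂₃)))
          where
          e₁₂ = apart-edge a₁ a₂ v₁₂

    goodman : ⊥
    goodman = start (distinct₂ L U (≤-trans (s≤s (s≤s z≤n)) 6≤))
      where
      finish : ∀ {v} → (∃ λ x → ∃₂ λ y z → x ∈ L × y ∈ L × z ∈ L × v ≢ x × v ≢ y × v ≢ z ×
        Mono₃ x y z × c v x ≡ c v y × c v x ≡ c v z × c v x ≢ c x y) → ⊥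
      finish (x , y , z , x∈ , y∈ , z∈ , _ , _ , _ , m , _) = no-triangle x∈ y∈ z∈ m
      start : (∃₂ λ v v′ → v ∈ L × v′ ∈ L × v ≢ v′) → ⊥
      -- By `no-triangle` no vertex lies in a triangle, in particular not v; but then
      -- `outside-triangle` produces one.
      start (v , _ , v∈ , _) = finish (outside-triangle v∈ no-triangle′)
        where
        no-triangle′ : Outside v
        no-triangle′ = no-triangle v∈

  two-colored-≤5 : ∀ {p q L} → Unique L → (∀ {x y} → x ∈ L → y ∈ L → x ≢ y → Between p q x y) →
    AtMostOne L → length L ≤ 5
  two-colored-≤5 U b one = ≮⇒≥ λ 6≤ → goodman U 6≤ b one

  -- The outcomes of Gallai's theorem. `twoColorVertex`: the triangle is not inside one component,
  -- and u is a component by itself. `split`: a component M sees all the rest N in colour r.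
  -- `blowUp`: otherwise; M lies in one component and holds at least a fifth of the vertices. The
  -- `Occurs` fields guarantee that discarding an avoided colour really shortens the list of
  -- colours.
  data Decomposition (L : List A) : Set where
    twoColorVertex : ∀ p q {u w z} → u ∈ L → w ∈ L → z ∈ L → Mono₃ u w z →
      (∀ {y} → y ∈ L → y ≢ u → Between p q u y) → Decomposition L
    split : ∀ r M N → M ⊆ L → N ⊆ L → Unique M → Unique N → length L ≡ length M + length N →
      Avoids r M → Avoids r N → Occurs r L → Decomposition L
    blowUp : ∀ p q M → p ≢ q → Occurs p L → Occurs q L → M ⊆ L → Unique M → Avoids p M → Avoids q M →
      length L ≤ 5 * length M → Decomposition L

  decompose : ∀ L → Unique L → 2 ≤ length L → AtMostOne L → Decomposition L
  decompose L U 2≤ one with gallai-disconnected L U 2≤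
  ... | p , q , x₀ , y₀ , x₀∈ , y₀∈ , fx₀≢fy₀ = cross-case
    (any? (λ u → any? (λ w → any? (λ z → mono₃? u w z ×-dec ¬? (f u ≟ f w) ×-dec ¬? (f u ≟ f z)) L) L) L)
    where
    f = Components.component p q L
    cross : ∀ {x y} → x ∈ L → y ∈ L → f x ≢ f y → Between p q x y
    cross = Components.component-cross p q U
    mod : ∀ {x x′ y} → x ∈ L → x′ ∈ L → y ∈ L → f x ≡ f x′ → f x ≢ f y → c x y ≡ c x′ y
    mod = component-module p q U

    module Within (within : ∀ {x y z} → x ∈ L → y ∈ L → z ∈ L → Mono₃ x y z → f x ≡ f y) where

      -- By homogeneity x₂y has colour r as well, so an edge x₁x₂ of colour r would complete a
      -- triangle that leaves the component.
      avoid : ∀ {r x₁ x₂ y} → x₁ ∈ L → x₂ ∈ L → x₁ ≢ x₂ → f x₁ ≡ f x₂ → y ∈ L → f x₁ ≢ f y → c x₁ y ≡ r → c x₁ x₂ ≢ r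
      avoid x₁∈ x₂∈ x₁≢x₂ e y∈ fx≢fy x₁y≡r x₁x₂≡r =
        fx≢fy (within x₁∈ y∈ x₂∈ ((λ { refl → fx≢fy refl }) , x₁≢x₂ , (λ { refl → fx≢fy e }) ,
          trans x₁y≡r (sym x₁x₂≡r) , trans (mod x₁∈ x₂∈ y∈ e fx≢fy) (c-sym _ _)))

      star : ∀ {x} r → x ∈ L → (∀ {y} → y ∈ L → f y ≡ f x ⊎ c x y ≡ r) → Decomposition L
      star {x} r x∈ s = split r M N (filter-⊆ C? L) (filter-⊆ (∁? C?) L) (Unique.filter⁺ C? U) (Unique.filter⁺ (∁? C?) U)
        (length-filter+length-filter-∁ C? L)
        (λ {x₁} {x₂} x₁∈ x₂∈ x₁≢x₂ → avoid (∈M x₁∈) (∈M x₂∈) x₁≢x₂ (trans (fM x₁∈) (sym (fM x₂∈))) y∈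
          (λ e → fx≢fy (trans (sym (fM x₁∈)) e))
          (trans (mod (∈M x₁∈) x∈ y∈ (fM x₁∈) (λ e → fx≢fy (trans (sym (fM x₁∈)) e))) xy≡r))
        -- All of N is seen from x in colour r, so an edge of colour r within N would form with x a
        -- triangle that leaves the component of x.
        (λ {y₁} {y₂} y₁∈ y₂∈ y₁≢y₂ y₁y₂≡r → fN y₁∈ (sym (within x∈ (∈N y₁∈) (∈N y₂∈)
          ((λ { refl → fN y₁∈ refl }) , (λ { refl → fN y₂∈ refl }) , y₁≢y₂ ,
            trans (to-r y₁∈) (sym (to-r y₂∈)) , trans (to-r y₁∈) (sym y₁y₂≡r)))))
        (x , y , x∈ , y∈ , fx≢fy ∘ cong f , xy≡r)
        where
        C? : Decidable (λ y → f y ≡ f x)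
        C? y = f y ≟ f x
        M = filter C? L
        N = filter (∁? C?) L
        ∈M : ∀ {y} → y ∈ M → y ∈ L
        ∈M = filter-⊆ C? L
        ∈N : ∀ {y} → y ∈ N → y ∈ L
        ∈N = filter-⊆ (∁? C?) L
        fM : ∀ {y} → y ∈ M → f y ≡ f x
        fM y∈ = proj₂ (∈-filter⁻ C? {xs = L} y∈)
        fN : ∀ {y} → y ∈ N → f y ≢ f x
        fN y∈ = proj₂ (∈-filter⁻ (∁? C?) {xs = L} y∈)
        to-r : ∀ {y} → y ∈ N → c x y ≡ r
        to-r y∈ = [ ⊥-elim ∘ fN y∈ , id ]′ (s (∈N y∈))
        elsewhere : ∃ λ y → y ∈ L × f x ≢ f y
        elsewhere with f x₀ ≟ f x
        ... | yes e = y₀ , y₀∈ , λ e′ → fx₀≢fy₀ (trans e e′)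
        ... | no ¬e = x₀ , x₀∈ , ¬e ∘ sym
        y = proj₁ elsewhere
        y∈ = proj₁ (proj₂ elsewhere)
        fx≢fy = proj₂ (proj₂ elsewhere)
        xy≡r = [ ⊥-elim ∘ fx≢fy ∘ sym , id ]′ (s y∈)

      Star : K → A → Set
      Star r x = All (λ y → f y ≡ f x ⊎ c x y ≡ r) L

      star? : ∀ r x → Dec (Star r x)
      star? r x = all? (λ y → (f y ≟ f x) ⊎-dec (c x y ≟ᶜ r)) L

      ¬star : ∀ {r x} → ¬ Star r x → ∃ λ y → y ∈ L × f x ≢ f y × c x y ≢ r
      ¬star {r} {x} ¬s with find (All.¬All⇒Any¬ (λ y → (f y ≟ f x) ⊎-dec (c x y ≟ᶜ r)) L ¬s)
      ... | y , y∈ , ¬e = y , y∈ , ¬e ∘ inj₁ ∘ sym , ¬e ∘ inj₂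

      within-case : Decomposition L
      within-case with any? (λ x → star? p x ⊎-dec star? q x) L
      ... | yes s with find s
      ...   | x , x∈ , inj₁ sp = star p x∈ (All.lookup sp)
      ...   | x , x∈ , inj₂ sq = star q x∈ (All.lookup sq)
      -- Representatives of distinct components span only edges coloured p or q, so Goodman's
      -- theorem allows at most five components.
      within-case | no ¬s = prime (large-fibre _≟_ f 5 L U λ R R⊆ UR →
        two-colored-≤5 (Unique.map⁻ UR) (λ x∈ y∈ x≢y → cross (R⊆ x∈) (R⊆ y∈) (Unique-map⁻ UR x∈ y∈ x≢y))
          (AtMostOne-⊆ R⊆ one))
        where
        -- If x is no star for q, some edge from x to another component is not coloured q, hence is
        -- coloured p. This edge also shows that p and q differ.
        p-neighbour : ∀ {x} → x ∈ L → ∃ λ y → y ∈ L × f x ≢ f y × c x y ≡ p × c x y ≢ q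
        p-neighbour x∈ with ¬star (λ sq → ¬s (lose x∈ (inj₂ sq)))
        ... | y , y∈ , fx≢fy , ≢q = y , y∈ , fx≢fy , [ id , ⊥-elim ∘ ≢q ]′ (cross x∈ y∈ fx≢fy) , ≢q
        q-neighbour : ∀ {x} → x ∈ L → ∃ λ y → y ∈ L × f x ≢ f y × c x y ≡ q
        q-neighbour x∈ with ¬star (λ sp → ¬s (lose x∈ (inj₁ sp)))
        ... | y , y∈ , fx≢fy , ≢p = y , y∈ , fx≢fy , [ ⊥-elim ∘ ≢p , id ]′ (cross x∈ y∈ fx≢fy)
        prime : LargeFibre f 5 L → Decomposition L
        prime (M , M⊆ , UM , fM , len) with p-neighbour x₀∈ | q-neighbour x₀∈
        ... | y , y∈ , fx≢fy , ≡p , ≢q | y′ , y′∈ , fx≢fy′ , ≡q =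
          blowUp p q M (λ p≡q → ≢q (trans ≡p p≡q))
            (x₀ , y , x₀∈ , y∈ , (λ { refl → fx≢fy refl }) , ≡p)
            (x₀ , y′ , x₀∈ , y′∈ , (λ { refl → fx≢fy′ refl }) , ≡q)
            M⊆ UM avoid-p avoid-q len
          where
          avoid-p : Avoids p M
          avoid-p x∈ x′∈ x≢x′ with p-neighbour (M⊆ x∈)
          ... | y , y∈ , fx≢fy , ≡p , _ = avoid (M⊆ x∈) (M⊆ x′∈) x≢x′ (fM x∈ x′∈) y∈ fx≢fy ≡p
          avoid-q : Avoids q M
          avoid-q x∈ x′∈ x≢x′ with q-neighbour (M⊆ x∈)
          ... | y , y∈ , fx≢fy , ≡q = avoid (M⊆ x∈) (M⊆ x′∈) x≢x′ (fM x∈ x′∈) y∈ fx≢fy ≡q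

    -- A triangle not inside one component always has a vertex u whose component contains neither of
    -- the other two.
    Cross : A → A → A → Set
    Cross u w z = Mono₃ u w z × f u ≢ f w × f u ≢ f z

    cross-case : Dec (Any (λ u → Any (λ w → Any (Cross u w) L) L) L) → Decomposition L
    cross-case (yes t) with find t
    ... | u , u∈ , t′ with find t′
    ...   | w , w∈ , t″ with find t″
    ...     | z , z∈ , m@(_ , _ , wz , euw , ewz) , fu≢fw , fu≢fz =
      twoColorVertex p q u∈ w∈ z∈ m λ {y} y∈ y≢u → cross u∈ y∈ (alone y∈ y≢u)
      where
      -- Another vertex of the component of u would form a second triangle with w and z.
      alone : ∀ {y} → y ∈ L → y ≢ u → f u ≢ f y
      alone {y} y∈ y≢u fu≡fy
        with one u∈ w∈ z∈ y∈ w∈ z∈ m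
               ( (λ { refl → fu≢fw fu≡fy }) , (λ { refl → fu≢fz fu≡fy }) , wz
               , trans (sym yw) (trans euw yz) , trans (sym yw) ewz )
        where
        yw = mod u∈ y∈ w∈ fu≡fy fu≢fw
        yz = mod u∈ y∈ z∈ fu≡fy fu≢fz
      ... | here e = y≢u e
      ... | there (here refl) = fu≢fw fu≡fy
      ... | there (there (here refl)) = fu≢fz fu≡fy
    cross-case (no ¬t) = Within.within-case within
      where
      none : ∀ {u w z} → u ∈ L → w ∈ L → z ∈ L → ¬ Cross u w z
      none u∈ w∈ z∈ m = ¬t (lose u∈ (lose w∈ (lose z∈ m)))
      within : ∀ {x y z} → x ∈ L → y ∈ L → z ∈ L → Mono₃ x y z → f x ≡ f y
      within {x} {y} {z} x∈ y∈ z∈ m with f x ≟ f y | f x ≟ f z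
      ... | yes e | _ = e
      ... | no ¬e | no ¬e′ = ⊥-elim (none x∈ y∈ z∈ (m , ¬e , ¬e′))
      ... | no ¬e | yes e′ = ⊥-elim (none y∈ x∈ z∈ (Mono₃-swap m , ¬e ∘ sym , λ e″ → ¬e (trans e′ (sym e″))))

-- Size bounds

-- Twice the larger part gives 4 * y; the factor 5 is what one colour is worth in `SquareBound`.
sum-square-≤ : ∀ {a b y} → a * a ≤ y → b * b ≤ y → (a + b) * (a + b) ≤ 5 * y
sum-square-≤ {a} {b} {y} p q with ≤-total a b
... | inj₁ a≤b = begin
  (a + b) * (a + b)  ≤⟨ *-mono-≤ (+-monoˡ-≤ b a≤b) (+-monoˡ-≤ b a≤b) ⟩
  (b + b) * (b + b)  ≡⟨ e b ⟩
  4 * (b * b)        ≤⟨ *-mono-≤ (n≤1+n 4) q ⟩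
  5 * y              ∎
  where
  open ≤-Reasoning
  e : ∀ b → (b + b) * (b + b) ≡ 4 * (b * b)
  e = solve-∀
... | inj₂ b≤a = begin
  (a + b) * (a + b)  ≤⟨ *-mono-≤ (+-monoʳ-≤ a b≤a) (+-monoʳ-≤ a b≤a) ⟩
  (a + a) * (a + a)  ≡⟨ e a ⟩
  4 * (a * a)        ≤⟨ *-mono-≤ (n≤1+n 4) p ⟩
  5 * y              ∎
  where
  open ≤-Reasoning
  e : ∀ b → (b + b) * (b + b) ≡ 4 * (b * b)
  e = solve-∀

5^[t*2] : ∀ t → 5 ^ (t * 2) ≡ 5 ^ t * 5 ^ t
5^[t*2] zero = refl
5^[t*2] (suc t) = trans (cong (λ z → 5 * (5 * z)) (5^[t*2] t)) (e (5 ^ t))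
  where
  e : ∀ x → 5 * (5 * (x * x)) ≡ 5 * x * (5 * x)
  e = solve-∀

-- √5³ < 12
x²≤5^odd⇒x<12*5^ : ∀ t {x} → x * x ≤ 5 ^ (3 + t * 2) → x < 12 * 5 ^ t
x²≤5^odd⇒x<12*5^ t {x} p = ≰⇒> λ q → <⇒≱ (begin-strict
  x * x                ≤⟨ p ⟩
  5 ^ (3 + t * 2)      ≡⟨ trans (cong (λ z → 5 * (5 * (5 * z))) (5^[t*2] t)) (e₁ X) ⟩
  125 * (X * X)        <⟨ *-monoˡ-< (X * X) {{m*n≢0 X X}} {125} {144} (m<m+n 125 (s≤s z≤n)) ⟩
  144 * (X * X)        ≡⟨ e₂ X ⟩
  12 * X * (12 * X)    ∎) (*-mono-≤ q q)
  where
  open ≤-Reasoning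
  X = 5 ^ t
  instance
    X≢0 : NonZero X
    X≢0 = m^n≢0 5 t
  e₁ : ∀ x → 5 * (5 * (5 * (x * x))) ≡ 125 * (x * x)
  e₁ = solve-∀
  e₂ : ∀ x → 144 * (x * x) ≡ 12 * x * (12 * x)
  e₂ = solve-∀

-- Strictness of a < 12 * 5 ^ t leaves room for one more vertex in each part, and 12 + 12 ≤ 25.
two-parts-bound : ∀ t {a b} → a * a ≤ 5 ^ (3 + t * 2) → b * b ≤ 5 ^ (3 + t * 2) → 2 + (a + b) ≤ 5 ^ (2 + t)
two-parts-bound t {a} {b} p q = begin
  2 + (a + b)            ≡⟨ e₁ a b ⟩
  suc a + suc b          ≤⟨ +-mono-≤ (x²≤5^odd⇒x<12*5^ t p) (x²≤5^odd⇒x<12*5^ t q) ⟩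
  12 * X + 12 * X        ≤⟨ m≤m+n _ X ⟩
  12 * X + 12 * X + X    ≡⟨ e₂ X ⟩
  5 * (5 * X)            ∎
  where
  open ≤-Reasoning
  X = 5 ^ t
  e₁ : ∀ a b → 2 + (a + b) ≡ suc a + suc b
  e₁ = solve-∀
  e₂ : ∀ x → 12 * x + 12 * x + x ≡ 5 * (5 * x)
  e₂ = solve-∀

module TriangleFreeBounds {A K : Set} (_≟_ : DecidableEquality A) (_≟ᶜ_ : DecidableEquality K)
  (c : A → A → K) (c-sym : ∀ x y → c x y ≡ c y x)
  (nonRainbow : ∀ x y z → c x y ≡ c x z ⊎ c x y ≡ c y z ⊎ c x z ≡ c y z) where

  open GallaiColored _≟_ _≟ᶜ_ c c-sym nonRainbow
  open TriangleBounds _≟_ _≟ᶜ_ c c-sym nonRainbow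

  Colors-remove : ∀ {S r L} → Avoids r L → Colors S L → Colors (remove _≟ᶜ_ r S) L
  Colors-remove {S} {r} av col x∈ y∈ x≢y = ∈-filter⁺ (λ s → ¬? (s ≟ᶜ r)) (col x∈ y∈ x≢y) (av x∈ y∈ x≢y)

  occurs-color : ∀ {S r L} → Colors S L → Occurs r L → r ∈ S
  occurs-color col (x , y , x∈ , y∈ , x≢y , refl) = col x∈ y∈ x≢y

  remove-≤ : ∀ {r} {S : List K} {s} → r ∈ S → length S ≤ suc s → length (remove _≟ᶜ_ r S) ≤ s
  remove-≤ r∈ len = ≤-pred (≤-trans (length-remove-∈ _≟ᶜ_ r∈) len)

  SquareBound : ℕ → Set
  SquareBound s = ∀ S L → length S ≤ s → Unique L → Colors S L → TriangleFree L → length L * length L ≤ 5 ^ s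

  small-bound : ∀ s {n} → n ≤ 1 → n * n ≤ 5 ^ s
  small-bound s n≤1 = ≤-trans (*-mono-≤ n≤1 n≤1) (m^n>0 5 s)

  module _ {s} (IH : ∀ {s′} → s′ < s → SquareBound s′) where

    square-bound-split : ∀ {S L r M N} → length S ≤ s → Colors S L → TriangleFree L → M ⊆ L → N ⊆ L →
      Unique M → Unique N → length L ≡ length M + length N → Avoids r M → Avoids r N → r ∈ S →
      length L * length L ≤ 5 ^ s
    square-bound-split {S} {L} {r} {M} {N} len col tf M⊆ N⊆ UM UN eq aM aN r∈ = go s refl
      where
      go : ∀ s′ → s ≡ s′ → length L * length L ≤ 5 ^ s
      go zero refl = ⊥-elim (<⇒≱ (∈-length r∈) len)
      go (suc s′) refl = subst (λ n → n * n ≤ 5 ^ suc s′) (sym eq) (sum-square-≤ {length M} {length N}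
        (IH ≤-refl (remove _≟ᶜ_ r S) M (remove-≤ r∈ len) UM (Colors-remove aM (Colors-⊆ M⊆ col)) (TriangleFree-⊆ M⊆ tf))
        (IH ≤-refl (remove _≟ᶜ_ r S) N (remove-≤ r∈ len) UN (Colors-remove aN (Colors-⊆ N⊆ col)) (TriangleFree-⊆ N⊆ tf)))

    square-bound-blowUp : ∀ {S L p q M} → length S ≤ s → Colors S L → TriangleFree L → M ⊆ L →
      Unique M → length L ≤ 5 * length M → Avoids p M → Avoids q M → p ≢ q → p ∈ S → q ∈ S →
      length L * length L ≤ 5 ^ s
    square-bound-blowUp {S} {L} {p} {q} {M} len col tf M⊆ UM bound aP aQ p≢q p∈ q∈ = go s refl
      where
      q∈′ : q ∈ remove _≟ᶜ_ p S
      q∈′ = ∈-filter⁺ (λ s → ¬? (s ≟ᶜ p)) q∈ (p≢q ∘ sym)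
      go : ∀ s′ → s ≡ s′ → length L * length L ≤ 5 ^ s
      go zero refl = ⊥-elim (<⇒≱ (∈-length p∈) len)
      go (suc zero) refl = ⊥-elim (<⇒≱ (∈-length q∈′) (remove-≤ p∈ len))
      go (suc (suc s′)) refl = begin
        length L * length L              ≤⟨ *-mono-≤ bound bound ⟩
        5 * length M * (5 * length M)    ≡⟨ e (length M) ⟩
        5 * (5 * (length M * length M))
          ≤⟨ *-monoʳ-≤ 5 (*-monoʳ-≤ 5 (IH (n≤1+n _) (remove _≟ᶜ_ q (remove _≟ᶜ_ p S)) M
               (remove-≤ q∈′ (remove-≤ p∈ len)) UM
               (Colors-remove aQ (Colors-remove aP (Colors-⊆ M⊆ col))) (TriangleFree-⊆ M⊆ tf))) ⟩
        5 * (5 * 5 ^ s′)                 ∎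
        where
        open ≤-Reasoning
        e : ∀ m → 5 * m * (5 * m) ≡ 5 * (5 * (m * m))
        e = solve-∀

  -- Strong induction, because a split uses up one colour and a blow-up two.
  square-bound : ∀ s → SquareBound s
  square-bound = <-rec SquareBound λ s IH S L len U col tf → case s IH S L len U col tf (2 ≤? length L)
    where
    case : ∀ s → (∀ {s′} → s′ < s → SquareBound s′) → ∀ S L → length S ≤ s → Unique L → Colors S L → TriangleFree L →
      Dec (2 ≤ length L) → length L * length L ≤ 5 ^ s
    case s IH S L len U col tf (no ≱2) = small-bound s (≤-pred (≰⇒> ≱2))
    case s IH S L len U col tf (yes 2≤) with decompose L U 2≤ (TriangleFree⇒AtMostOne tf)
    ... | twoColorVertex p q u∈ w∈ z∈ m _ = ⊥-elim (tf u∈ w∈ z∈ m)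
    ... | split r M N M⊆ N⊆ UM UN eq aM aN occ =
      square-bound-split IH len col tf M⊆ N⊆ UM UN eq aM aN (occurs-color col occ)
    ... | blowUp p q M p≢q occP occQ M⊆ UM aP aQ bound =
      square-bound-blowUp IH len col tf M⊆ UM bound aP aQ p≢q (occurs-color col occP) (occurs-color col occQ)

  -- Colourings with one monochromatic triangle

  TriangleFree-remove : ∀ {L u w z} → u ∈ L → w ∈ L → z ∈ L → Mono₃ u w z → AtMostOne L → TriangleFree (remove _≟_ u L)
  TriangleFree-remove {L} {u} {w} {z} u∈ w∈ z∈ m one {x} {y} {t} x∈ y∈ t∈ m′
    with one (proj₁ (∈-remove⁻ _≟_ u x∈)) (proj₁ (∈-remove⁻ _≟_ u y∈)) (proj₁ (∈-remove⁻ _≟_ u t∈)) u∈ w∈ z∈ m′ m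
  ... | here e = proj₂ (∈-remove⁻ _≟_ u {L} x∈) (sym e)
  ... | there (here e) = proj₂ (∈-remove⁻ _≟_ u {L} y∈) (sym e)
  ... | there (there (here e)) = proj₂ (∈-remove⁻ _≟_ u {L} t∈) (sym e)

  -- `pred` accounts for one deleted vertex. If the bound failed, L could contain no triangle, since
  -- deleting a vertex of it would leave a triangle-free list and prove the bound; but for
  -- triangle-free L the bound holds anyway. So no triangle has to be searched for.
  AtMostOne-square-bound : ∀ s S L → length S ≤ s → Unique L → Colors S L → AtMostOne L →
    pred (length L) * pred (length L) ≤ 5 ^ s
  AtMostOne-square-bound s S L len U col one = decidable-stable (_ ≤? _) λ ¬b → ¬b
    (≤-trans (*-mono-≤ (pred[n]≤n {length L}) (pred[n]≤n {length L}))
      (square-bound s S L len U col λ {u} u∈ w∈ z∈ m → ¬b (≤-trans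
        (*-mono-≤ (pred-mono-≤ (length-remove _≟_ u U)) (pred-mono-≤ (length-remove _≟_ u U)))
        (square-bound s S (remove _≟_ u L) len (remove-Unique _≟_ u U)
          (Colors-⊆ (proj₁ ∘ ∈-remove⁻ _≟_ u) col) (TriangleFree-remove u∈ w∈ z∈ m one)))))

  -- That r belongs to S is asked only when M has a vertex x: in the application r is the colour of
  -- the edge ux.
  avoiding-square-bound : ∀ s S r M → length S ≤ suc s → Unique M → Colors S M → TriangleFree M →
    Avoids r M → (∀ {x} → x ∈ M → r ∈ S) → length M * length M ≤ 5 ^ s
  avoiding-square-bound s S r [] len U col tf av r∈ = z≤n
  avoiding-square-bound s S r M@(_ ∷ _) len U col tf av r∈ =
    square-bound s (remove _≟ᶜ_ r S) M (remove-≤ (r∈ (here refl)) len) U (Colors-remove av col) tf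

  -- Two vertices that u sees in the same colour r are not joined by an edge of colour r, except w
  -- and z: otherwise u would lie in a second triangle. So u and w are deleted, and the rest falls
  -- into the p-neighbours of u, which avoid p, and the q-neighbours, which avoid q.
  two-color-vertex-bound : ∀ t S L → length S ≤ 4 + t * 2 → Unique L → Colors S L → AtMostOne L →
    ∀ {p q u w z} → u ∈ L → w ∈ L → z ∈ L → Mono₃ u w z → (∀ {y} → y ∈ L → y ≢ u → Between p q u y) →
    length L ≤ 5 ^ (2 + t)
  two-color-vertex-bound t S L len U col one {p} {q} {u} {w} {z} u∈ w∈ z∈ m b =
    ≤-trans (≤-trans (length-remove _≟_ u U) (s≤s (length-remove _≟_ w (remove-Unique _≟_ u U))))
      (≤-trans (≤-reflexive (cong (2 +_) (length-filter+length-filter-∁ P? R)))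
        (two-parts-bound t {length P} {length Q}
          (avoiding-square-bound _ S p P len (Unique.filter⁺ P? UR) (Colors-⊆ (R⊆ ∘ filter-⊆ P? R) col)
            (TriangleFree-⊆ (filter-⊆ P? R) tf) (avoid (filter-⊆ P? R) uP)
            (λ x∈ → subst (_∈ S) (uP x∈) (col u∈ (R⊆ (filter-⊆ P? R x∈)) (≢u (filter-⊆ P? R x∈) ∘ sym))))
          (avoiding-square-bound _ S q Q len (Unique.filter⁺ (∁? P?) UR) (Colors-⊆ (R⊆ ∘ filter-⊆ (∁? P?) R) col)
            (TriangleFree-⊆ (filter-⊆ (∁? P?) R) tf) (avoid (filter-⊆ (∁? P?) R) uQ)
            (λ x∈ → subst (_∈ S) (uQ x∈) (col u∈ (R⊆ (filter-⊆ (∁? P?) R x∈)) (≢u (filter-⊆ (∁? P?) R x∈) ∘ sym))))))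
    where
    P? : Decidable (λ x → c u x ≡ p)
    P? x = c u x ≟ᶜ p
    R = remove _≟_ w (remove _≟_ u L)
    P = filter P? R
    Q = filter (∁? P?) R
    UR = remove-Unique _≟_ w (remove-Unique _≟_ u U)
    R⊆ : ∀ {x} → x ∈ R → x ∈ L
    R⊆ x∈ = proj₁ (∈-remove⁻ _≟_ u (proj₁ (∈-remove⁻ _≟_ w x∈)))
    ≢u : ∀ {x} → x ∈ R → x ≢ u
    ≢u x∈ = proj₂ (∈-remove⁻ _≟_ u {L} (proj₁ (∈-remove⁻ _≟_ w x∈)))
    ≢w : ∀ {x} → x ∈ R → x ≢ w
    ≢w x∈ = proj₂ (∈-remove⁻ _≟_ w {remove _≟_ u L} x∈)
    tf : TriangleFree R
    tf = TriangleFree-⊆ (proj₁ ∘ ∈-remove⁻ _≟_ w) (TriangleFree-remove u∈ w∈ z∈ m one)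
    uP : ∀ {x} → x ∈ P → c u x ≡ p
    uP x∈ = proj₂ (∈-filter⁻ P? {xs = R} x∈)
    uQ : ∀ {x} → x ∈ Q → c u x ≡ q
    uQ x∈ with ∈-filter⁻ (∁? P?) {xs = R} x∈
    ... | x∈R , ¬p = [ ⊥-elim ∘ ¬p , id ]′ (b (R⊆ x∈R) (≢u x∈R))
    avoid : ∀ {r M} → (∀ {x} → x ∈ M → x ∈ R) → (∀ {x} → x ∈ M → c u x ≡ r) → Avoids r M
    avoid M⊆ um x∈ y∈ x≢y xy≡r
      -- The known triangle is rotated to start at w, so that w has to be u, x or y, all of which
      -- are excluded.
      with one u∈ (R⊆ (M⊆ x∈)) (R⊆ (M⊆ y∈)) w∈ z∈ u∈
             (≢u (M⊆ x∈) ∘ sym , ≢u (M⊆ y∈) ∘ sym , x≢y , trans (um x∈) (sym (um y∈)) , trans (um x∈) (sym xy≡r))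
             (Mono₃-rotate m)
    ... | here refl = proj₁ m refl
    ... | there (here refl) = ≢w (M⊆ x∈) refl
    ... | there (there (here refl)) = ≢w (M⊆ y∈) refl

  AtMostOneBound : ℕ → Set
  AtMostOneBound t = ∀ S L → length S ≤ t * 2 → Unique L → Colors S L → AtMostOne L → length L ≤ 5 ^ t

  at-most-one-bound-0 : AtMostOneBound 0
  at-most-one-bound-0 [] L len U col one = ≮⇒≥ λ 2≤ → edge (distinct₂ L U 2≤)
    where
    edge : ¬ (∃₂ λ x y → x ∈ L × y ∈ L × x ≢ y)
    edge (x , y , x∈ , y∈ , x≢y) with col x∈ y∈ x≢y
    ... | ()

  -- The general step would fail here: a split into two one-coloured parts with pred² ≤ 5 only gives
  -- 3 + 3 vertices.
  at-most-one-bound-1 : AtMostOneBound 1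
  at-most-one-bound-1 [] L len U col one = ≤-trans (at-most-one-bound-0 [] L z≤n U col one) (s≤s z≤n)
  at-most-one-bound-1 (p ∷ []) L len U col one = two-colored-≤5 {p} {p} U b one
    where
    b : ∀ {x y} → x ∈ L → y ∈ L → x ≢ y → Between p p x y
    b x∈ y∈ x≢y with col x∈ y∈ x≢y
    ... | here e = inj₁ e
  at-most-one-bound-1 (p ∷ q ∷ []) L len U col one = two-colored-≤5 {p} {q} U b one
    where
    b : ∀ {x y} → x ∈ L → y ∈ L → x ≢ y → Between p q x y
    b x∈ y∈ x≢y with col x∈ y∈ x≢y
    ... | here e = inj₁ e
    ... | there (here e) = inj₂ e
  at-most-one-bound-1 (_ ∷ _ ∷ _ ∷ _) L (s≤s (s≤s ())) U col one

  at-most-one-bound-step : ∀ t → AtMostOneBound (suc t) → AtMostOneBound (suc (suc t))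
  at-most-one-bound-step t IH S L len U col one with 2 ≤? length L
  ... | no ≱2 = ≤-trans (≤-pred (≰⇒> ≱2)) (m^n>0 5 (2 + t))
  ... | yes 2≤ with decompose L U 2≤ one
  ...   | twoColorVertex p q u∈ w∈ z∈ m b = two-color-vertex-bound t S L len U col one u∈ w∈ z∈ m b
  -- Either part may contain the triangle, so one vertex is given up in each; these are the 2 in
  -- `two-parts-bound`.
  ...   | split r M N M⊆ N⊆ UM UN eq aM aN occ = ≤-trans (≤-reflexive eq)
    (≤-trans (≤-trans (+-mono-≤ (suc-pred-≤ (length M)) (suc-pred-≤ (length N))) (≤-reflexive (cong suc (+-suc _ _))))
      (two-parts-bound t {pred (length M)} {pred (length N)} (bound M M⊆ UM aM) (bound N N⊆ UN aN)))
    where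
    suc-pred-≤ : ∀ n → n ≤ suc (pred n)
    suc-pred-≤ zero = z≤n
    suc-pred-≤ (suc n) = ≤-refl
    bound : ∀ M → M ⊆ L → Unique M → Avoids r M → pred (length M) * pred (length M) ≤ 5 ^ (3 + t * 2)
    bound M M⊆ UM aM = AtMostOne-square-bound _ (remove _≟ᶜ_ r S) M (remove-≤ (occurs-color col occ) len) UM
      (Colors-remove aM (Colors-⊆ M⊆ col)) (AtMostOne-⊆ M⊆ one)
  ...   | blowUp p q M p≢q occP occQ M⊆ UM aP aQ bound = ≤-trans bound (*-monoʳ-≤ 5
    (IH (remove _≟ᶜ_ q (remove _≟ᶜ_ p S)) M
      (remove-≤ (∈-filter⁺ (λ s → ¬? (s ≟ᶜ p)) (occurs-color col occQ) (p≢q ∘ sym)) (remove-≤ (occurs-color col occP) len))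
      UM (Colors-remove aQ (Colors-remove aP (Colors-⊆ M⊆ col))) (AtMostOne-⊆ M⊆ one)))

  at-most-one-bound : ∀ t → AtMostOneBound t
  at-most-one-bound zero = at-most-one-bound-0
  at-most-one-bound (suc zero) = at-most-one-bound-1
  at-most-one-bound (suc (suc t)) = at-most-one-bound-step t (at-most-one-bound (suc t))

-- Substitution into the pentagon

module _ {V : Set} where

  -- Tuples are taken by position in the list. Concatenation then replaces index arithmetic in
  -- `Fin n`, and a list may repeat a vertex.
  pairs : (V → V → ℕ) → List V → ℕ
  pairs f [] = 0
  pairs f (x ∷ L) = sumList (map (f x) L) + pairs f L

  triples : (V → V → V → ℕ) → List V → ℕ
  triples f [] = 0
  triples f (x ∷ L) = pairs (f x) L + triples f L

  ∑≡pairs : ∀ {n} (v : Fin n → V) (f : V → V → ℕ) (g : Fin n → Fin n → ℕ) →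
    (∀ j l → toℕ j < toℕ l → g j l ≡ f (v j) (v l)) → (∀ j l → ¬ toℕ j < toℕ l → g j l ≡ 0) →
    ∑[ j < n ] ∑[ l < n ] g j l ≡ pairs f (tabulate v)
  ∑≡pairs {zero} v f g g< g≮ = refl
  ∑≡pairs {suc n} v f g g< g≮ = cong₂ _+_ head tail
    where
    open ≡-Reasoning
    head : ∑[ l < suc n ] g zero l ≡ sumList (map (f (v zero)) (tabulate (v ∘ suc)))
    head = begin
      g zero zero + ∑[ l < n ] g zero (suc l)   ≡⟨ cong₂ _+_ (g≮ zero zero λ ()) (sum-cong-≗ λ l → g< zero (suc l) (s≤s z≤n)) ⟩
      ∑[ l < n ] f (v zero) (v (suc l))         ≡⟨ sumList-allFin n (f (v zero) ∘ v ∘ suc) ⟨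
      sumList (map (f (v zero) ∘ v ∘ suc) (allFin n))
        ≡⟨ cong sumList (trans (List.map-tabulate id (f (v zero) ∘ v ∘ suc))
             (sym (List.map-tabulate (v ∘ suc) (f (v zero))))) ⟩
      sumList (map (f (v zero)) (tabulate (v ∘ suc)))  ∎
    tail : ∑[ j < n ] ∑[ l < suc n ] g (suc j) l ≡ pairs f (tabulate (v ∘ suc))
    tail = trans (sum-cong-≗ λ j → cong (_+ ∑[ l < n ] g (suc j) (suc l)) (g≮ (suc j) zero λ ()))
      (∑≡pairs (v ∘ suc) f (λ j l → g (suc j) (suc l)) (λ j l j<l → g< (suc j) (suc l) (s≤s j<l))
        (λ j l j≮l → g≮ (suc j) (suc l) (j≮l ∘ ≤-pred)))

  ∑≡triples : ∀ {n} (v : Fin n → V) (f : V → V → V → ℕ) (g : Fin n → Fin n → Fin n → ℕ) →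
    (∀ i j l → Ordered3 i j l → g i j l ≡ f (v i) (v j) (v l)) → (∀ i j l → ¬ Ordered3 i j l → g i j l ≡ 0) →
    ∑[ i < n ] ∑[ j < n ] ∑[ l < n ] g i j l ≡ triples f (tabulate v)
  ∑≡triples {zero} v f g g< g≮ = refl
  ∑≡triples {suc n} v f g g< g≮ = cong₂ _+_ head tail
    where
    head : ∑[ j < suc n ] ∑[ l < suc n ] g zero j l ≡ pairs (f (v zero)) (tabulate (v ∘ suc))
    head = cong₂ _+_ (sum-≡0 (g zero zero) λ l → g≮ zero zero l λ ())
      (trans (sum-cong-≗ λ j → cong (_+ ∑[ l < n ] g zero (suc j) (suc l)) (g≮ zero (suc j) zero λ ()))
        (∑≡pairs (v ∘ suc) (f (v zero)) (λ j l → g zero (suc j) (suc l))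
          (λ j l j<l → g< zero (suc j) (suc l) (s≤s z≤n , s≤s j<l))
          (λ j l j≮l → g≮ zero (suc j) (suc l) (j≮l ∘ ≤-pred ∘ proj₂))))
    tail : ∑[ i < n ] ∑[ j < suc n ] ∑[ l < suc n ] g (suc i) j l ≡ triples f (tabulate (v ∘ suc))
    tail = trans (sum-cong-≗ λ i → cong₂ _+_ (sum-≡0 (g (suc i) zero) λ l → g≮ (suc i) zero l λ ())
        (sum-cong-≗ λ j → cong (_+ ∑[ l < n ] g (suc i) (suc j) (suc l)) (g≮ (suc i) (suc j) zero λ ())))
      (∑≡triples (v ∘ suc) f (λ i j l → g (suc i) (suc j) (suc l))
        (λ i j l o → g< (suc i) (suc j) (suc l) (s≤s (proj₁ o) , s≤s (proj₂ o)))
        (λ i j l ¬o → g≮ (suc i) (suc j) (suc l) (λ o → ¬o (≤-pred (proj₁ o) , ≤-pred (proj₂ o)))))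

  sumList-map-≡0 : ∀ (f : V → ℕ) L → (∀ {x} → x ∈ L → f x ≡ 0) → sumList (map f L) ≡ 0
  sumList-map-≡0 f [] f≡0 = refl
  sumList-map-≡0 f (x ∷ L) f≡0 = cong₂ _+_ (f≡0 (here refl)) (sumList-map-≡0 f L (f≡0 ∘ there))

  pairs-≡0 : ∀ (f : V → V → ℕ) L → (∀ {x y} → x ∈ L → y ∈ L → f x y ≡ 0) → pairs f L ≡ 0
  pairs-≡0 f [] f≡0 = refl
  pairs-≡0 f (x ∷ L) f≡0 = cong₂ _+_ (sumList-map-≡0 (f x) L (f≡0 (here refl) ∘ there))
    (pairs-≡0 f L (λ x∈ y∈ → f≡0 (there x∈) (there y∈)))

  pairs-++ : ∀ (f : V → V → ℕ) L M → (∀ {x y} → x ∈ L → y ∈ M → f x y ≡ 0) →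
    pairs f (L ++ M) ≡ pairs f L + pairs f M
  pairs-++ f [] M f≡0 = refl
  pairs-++ f (x ∷ L) M f≡0 = begin
    sumList (map (f x) (L ++ M)) + pairs f (L ++ M)
      ≡⟨ cong₂ _+_ (trans (cong sumList (List.map-++ (f x) L M)) (sum-++ (map (f x) L) (map (f x) M)))
           (pairs-++ f L M (f≡0 ∘ there)) ⟩
    sumList (map (f x) L) + sumList (map (f x) M) + (pairs f L + pairs f M)
      ≡⟨ cong (λ s → sumList (map (f x) L) + s + (pairs f L + pairs f M)) (sumList-map-≡0 (f x) M (f≡0 (here refl))) ⟩
    sumList (map (f x) L) + 0 + (pairs f L + pairs f M)
      ≡⟨ e (sumList (map (f x) L)) (pairs f L) (pairs f M) ⟩
    sumList (map (f x) L) + pairs f L + pairs f M  ∎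
    where
    open ≡-Reasoning
    e : ∀ a b c → a + 0 + (b + c) ≡ a + b + c
    e = solve-∀

  triples-++ : ∀ (f : V → V → V → ℕ) L M → (∀ {x y z} → x ∈ L → y ∈ L → z ∈ M → f x y z ≡ 0) →
    (∀ {x y z} → x ∈ L → y ∈ M → z ∈ M → f x y z ≡ 0) → triples f (L ++ M) ≡ triples f L + triples f M
  triples-++ f [] M f≡0 f≡0′ = refl
  triples-++ f (x ∷ L) M f≡0 f≡0′ = begin
    pairs (f x) (L ++ M) + triples f (L ++ M)
      ≡⟨ cong₂ _+_ (pairs-++ (f x) L M (f≡0 (here refl) ∘ there))
           (triples-++ f L M (λ x∈ y∈ → f≡0 (there x∈) (there y∈)) (f≡0′ ∘ there)) ⟩
    pairs (f x) L + pairs (f x) M + (triples f L + triples f M)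
      ≡⟨ cong (λ s → pairs (f x) L + s + (triples f L + triples f M)) (pairs-≡0 (f x) M (f≡0′ (here refl))) ⟩
    pairs (f x) L + 0 + (triples f L + triples f M)
      ≡⟨ e (pairs (f x) L) (triples f L) (triples f M) ⟩
    pairs (f x) L + triples f L + triples f M  ∎
    where
    open ≡-Reasoning
    e : ∀ a b c → a + 0 + (b + c) ≡ a + b + c
    e = solve-∀

module _ {V W : Set} (h : V → W) where

  pairs-map : ∀ (f : V → V → ℕ) (g : W → W → ℕ) → (∀ x y → g (h x) (h y) ≡ f x y) →
    ∀ L → pairs g (map h L) ≡ pairs f L
  pairs-map f g e [] = refl
  pairs-map f g e (x ∷ L) = cong₂ _+_ (cong sumList (trans (sym (List.map-∘ L)) (List.map-cong (e x) L))) (pairs-map f g e L)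

  triples-map : ∀ (f : V → V → V → ℕ) (g : W → W → W → ℕ) → (∀ x y z → g (h x) (h y) (h z) ≡ f x y z) →
    ∀ L → triples g (map h L) ≡ triples f L
  triples-map f g e [] = refl
  triples-map f g e (x ∷ L) = cong₂ _+_ (pairs-map (f x) (g (h x)) (e x) L) (triples-map f g e L)

NonRainbow : ∀ {k} {V : Set} → (V → V → Fin k) → Set
NonRainbow c = ∀ x y z → c x y ≡ c x z ⊎ c x y ≡ c y z ⊎ c x z ≡ c y z

mono : ∀ {k} {V : Set} → (V → V → Fin k) → V → V → V → ℕ
mono c x y z = if does ((c x y ≟ c x z) ×-dec (c x y ≟ c y z)) then 1 else 0

mono-≡0 : ∀ {k} {V : Set} (c : V → V → Fin k) {x y z} → ¬ (c x y ≡ c x z × c x y ≡ c y z) → mono c x y z ≡ 0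
mono-≡0 c {x} {y} {z} ¬m = cong (if_then 1 else 0) (dec-false ((c x y ≟ c x z) ×-dec (c x y ≟ c y z)) ¬m)

mono-≡1 : ∀ {k} {V : Set} (c : V → V → Fin k) {x y z} → c x y ≡ c x z × c x y ≡ c y z → mono c x y z ≡ 1
mono-≡1 c {x} {y} {z} m = cong (if_then 1 else 0) (dec-true ((c x y ≟ c x z) ×-dec (c x y ≟ c y z)) m)

mono-cong : ∀ {k k′} {V W : Set} (c : V → V → Fin k) (d : W → W → Fin k′) {x y z x′ y′ z′} →
  (c x y ≡ c x z × c x y ≡ c y z → d x′ y′ ≡ d x′ z′ × d x′ y′ ≡ d y′ z′) →
  (d x′ y′ ≡ d x′ z′ × d x′ y′ ≡ d y′ z′ → c x y ≡ c x z × c x y ≡ c y z) →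
  mono c x y z ≡ mono d x′ y′ z′
mono-cong c d {x} {y} {z} f g with (c x y ≟ c x z) ×-dec (c x y ≟ c y z)
... | yes m = trans (mono-≡1 c m) (sym (mono-≡1 d (f m)))
... | no ¬m = trans (mono-≡0 c ¬m) (sym (mono-≡0 d (¬m ∘ g)))

monoCount≡triples : ∀ {k n} {V : Set} (c : Coloring k n) (v : Fin n → V) (d : V → V → Fin k) →
  (∀ i j → toℕ i < toℕ j → c i j ≡ d (v i) (v j)) → monoCount c ≡ triples (mono d) (tabulate v)
monoCount≡triples c v d e = trans (monoCount≡∑ c) (∑≡triples v (mono d) (χ c) ordered
    (λ i j l ¬o → χ-no c i j l (¬o ∘ proj₁)))
  where
  ordered : ∀ i j l → Ordered3 i j l → χ c i j l ≡ mono d (v i) (v j) (v l)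
  ordered i j l o@(i<j , j<l) = by ((c i j ≟ c i l) ×-dec (c i j ≟ c j l))
    where
    by : Dec (Mono c i j l) → χ c i j l ≡ mono d (v i) (v j) (v l)
    by (yes m@(m₁ , m₂)) = trans (χ-yes c i j l (o , m)) (sym (mono-≡1 d
      ( trans (sym (e i j i<j)) (trans m₁ (e i l (<-trans i<j j<l)))
      , trans (sym (e i j i<j)) (trans m₂ (e j l j<l)))))
    by (no ¬m) = trans (χ-no c i j l (¬m ∘ proj₂)) (sym (mono-≡0 d λ (m₁ , m₂) → ¬m
      ( trans (e i j i<j) (trans m₁ (sym (e i l (<-trans i<j j<l))))
      , trans (e i j i<j) (trans m₂ (sym (e j l j<l))))))

-- A Gallai-coloured complete graph on a list of vertices: list positions play the role of Fin n.
record Block (k : ℕ) : Set₁ where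
  field
    {V} : Set
    color : V → V → Fin k
    color-sym : ∀ x y → color x y ≡ color y x
    nonRainbow : NonRainbow color
    vertices : List V

  size : ℕ
  size = length vertices

  count : ℕ
  count = triples (mono color) vertices

  coloring : Coloring k size
  coloring i j = color (lookup vertices i) (lookup vertices j)

  coloring-Gallai : Gallai coloring
  coloring-Gallai i j l _ (≢₁ , ≢₂ , ≢₃) with nonRainbow (lookup vertices i) (lookup vertices j) (lookup vertices l)
  ... | inj₁ e = ≢₁ e
  ... | inj₂ (inj₁ e) = ≢₂ e
  ... | inj₂ (inj₂ e) = ≢₃ e

  monoCount-coloring : monoCount coloring ≡ count
  monoCount-coloring = trans (monoCount≡triples coloring (lookup vertices) color (λ _ _ _ → refl))
    (cong (triples (mono color)) (List.tabulate-lookup vertices))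

open Block using (V; color; color-sym; nonRainbow; vertices; size; count)

two-colors-nonRainbow : ∀ (a b c : Fin 2) → a ≡ b ⊎ a ≡ c ⊎ b ≡ c
two-colors-nonRainbow zero zero _ = inj₁ refl
two-colors-nonRainbow zero (suc zero) zero = inj₂ (inj₁ refl)
two-colors-nonRainbow zero (suc zero) (suc zero) = inj₂ (inj₂ refl)
two-colors-nonRainbow (suc zero) zero zero = inj₂ (inj₂ refl)
two-colors-nonRainbow (suc zero) zero (suc zero) = inj₂ (inj₁ refl)
two-colors-nonRainbow (suc zero) (suc zero) _ = inj₁ refl

-- Colour `zero` is the 5-cycle modulo 5, and the other colour off the diagonal is its complement,
-- again a 5-cycle.
pentagon : Fin 5 → Fin 5 → Fin 2
pentagon i j = if does (∣ toℕ i - toℕ j ∣ ≟ℕ 1) ∨ does (∣ toℕ i - toℕ j ∣ ≟ℕ 4) then zero else suc zero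
  where open import Data.Nat using () renaming (_≟_ to _≟ℕ_)

pentagon-sym : ∀ i j → pentagon i j ≡ pentagon j i
pentagon-sym = from-yes (all-Fin? λ i → all-Fin? λ j → pentagon i j ≟ pentagon j i)

pentagon-triangleFree : ∀ i j l → i ≢ j → i ≢ l → j ≢ l → ¬ (pentagon i j ≡ pentagon i l × pentagon i j ≡ pentagon j l)
pentagon-triangleFree = from-yes (all-Fin? λ i → all-Fin? λ j → all-Fin? λ l →
  ¬? (i ≟ j) →-dec (¬? (i ≟ l) →-dec (¬? (j ≟ l) →-dec
    ¬? ((pentagon i j ≟ pentagon i l) ×-dec (pentagon i j ≟ pentagon j l)))))

pentagonBlock : Block 2
pentagonBlock = record
  { color = pentagon
  ; color-sym = pentagon-sym
  ; nonRainbow = λ x y z → two-colors-nonRainbow (pentagon x y) (pentagon x z) (pentagon y z)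
  ; vertices = allFin 5
  }

module BlowUp {k} (b : Fin 5 → Block k) where

  Vertex : Set
  Vertex = Σ (Fin 5) λ i → V (b i)

  blowColor : Vertex → Vertex → Fin (2 + k)
  blowColor (i , x) (j , y) with i ≟ j
  ... | yes refl = 2 ↑ʳ color (b i) x y
  ... | no _ = pentagon i j ↑ˡ k

  blowColor-inner : ∀ i x y → blowColor (i , x) (i , y) ≡ 2 ↑ʳ color (b i) x y
  blowColor-inner i x y rewrite ≡-≟-identity _≟_ (refl {x = i}) = refl

  blowColor-outer : ∀ {i j} x y → i ≢ j → blowColor (i , x) (j , y) ≡ pentagon i j ↑ˡ k
  blowColor-outer {i} {j} x y i≢j with i ≟ j
  ... | yes i≡j = ⊥-elim (i≢j i≡j)
  ... | no _ = refl

  blowColor-outer-sym : ∀ {i j} x y z → i ≢ j → blowColor (i , x) (j , y) ≡ blowColor (j , y) (i , z)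
  blowColor-outer-sym {i} {j} x y z i≢j = trans (blowColor-outer x y i≢j)
    (trans (cong (_↑ˡ k) (pentagon-sym i j)) (sym (blowColor-outer y z (i≢j ∘ sym))))

  -- Inner colours are shifted to 2 and above, while pentagon colours are below 2.
  inner≢outer : ∀ {i u j} (x y : V (b i)) (x′ : V (b u)) (y′ : V (b j)) → u ≢ j →
    blowColor (i , x) (i , y) ≢ blowColor (u , x′) (j , y′)
  inner≢outer {i} {u} {j} x y x′ y′ u≢j e = <⇒≱ (toℕ<n (pentagon u j)) (≤-trans (m≤m+n 2 _)
    (≤-reflexive (trans (sym (toℕ-↑ʳ 2 (color (b i) x y))) (trans (cong toℕ
      (trans (sym (blowColor-inner i x y)) (trans e (blowColor-outer x′ y′ u≢j)))) (toℕ-↑ˡ (pentagon u j) k)))))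

  blowColor-sym : ∀ x y → blowColor x y ≡ blowColor y x
  blowColor-sym (i , x) (j , y) = by (i ≟ j)
    where
    by : Dec (i ≡ j) → blowColor (i , x) (j , y) ≡ blowColor (j , y) (i , x)
    by (yes refl) = trans (blowColor-inner i x y) (trans (cong (2 ↑ʳ_) (color-sym (b i) x y)) (sym (blowColor-inner i y x)))
    by (no i≢j) = blowColor-outer-sym x y x i≢j

  blowColor-nonRainbow : NonRainbow blowColor
  blowColor-nonRainbow (i , x) (j , y) (l , z) = by (i ≟ j) (i ≟ l) (j ≟ l)
    where
    c = blowColor
    X Y Z : Vertex
    X = i , x
    Y = j , y
    Z = l , z
    by : Dec (i ≡ j) → Dec (i ≡ l) → Dec (j ≡ l) → c X Y ≡ c X Z ⊎ c X Y ≡ c Y Z ⊎ c X Z ≡ c Y Z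
    by (yes refl) (yes refl) _ = Sum.map (lift x y x z) (Sum.map (lift x y y z) (lift x z y z)) (nonRainbow (b i) x y z)
      where
      lift : ∀ s t u v → color (b i) s t ≡ color (b i) u v → c (i , s) (i , t) ≡ c (i , u) (i , v)
      lift s t u v e = trans (blowColor-inner i s t) (trans (cong (2 ↑ʳ_) e) (sym (blowColor-inner i u v)))
    by (yes refl) (no i≢l) _ = inj₂ (inj₂ (trans (blowColor-outer x z i≢l) (sym (blowColor-outer y z i≢l))))
    by (no i≢j) (yes refl) _ = inj₂ (inj₁ (blowColor-outer-sym x y z i≢j))
    by (no i≢j) (no i≢l) (yes refl) = inj₁ (trans (blowColor-outer x y i≢j) (sym (blowColor-outer x z i≢l)))
    by (no i≢j) (no i≢l) (no j≢l) = Sum.map (lift x y x z i≢j i≢l) (Sum.map (lift x y y z i≢j j≢l) (lift x z y z i≢l j≢l))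
      (two-colors-nonRainbow (pentagon i j) (pentagon i l) (pentagon j l))
      where
      lift : ∀ {u u′ w w′} (s : V (b u)) (s′ : V (b u′)) (t : V (b w)) (t′ : V (b w′)) → u ≢ u′ → w ≢ w′ →
        pentagon u u′ ≡ pentagon w w′ → c (u , s) (u′ , s′) ≡ c (w , t) (w′ , t′)
      lift s s′ t t′ ≢₁ ≢₂ e = trans (blowColor-outer s s′ ≢₁) (trans (cong (_↑ˡ k) e) (sym (blowColor-outer t t′ ≢₂)))

  blowColor-mono-inner : ∀ i x y z → mono blowColor (i , x) (i , y) (i , z) ≡ mono (color (b i)) x y z
  blowColor-mono-inner i x y z = mono-cong blowColor (color (b i)) {i , x} {i , y} {i , z}
    (λ (e , e′) → lower x y x z e , lower x y y z e′) (λ (e , e′) → raise x y x z e , raise x y y z e′)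
    where
    lower : ∀ s t u v → blowColor (i , s) (i , t) ≡ blowColor (i , u) (i , v) → color (b i) s t ≡ color (b i) u v
    lower s t u v e = ↑ʳ-injective 2 _ _ (trans (sym (blowColor-inner i s t)) (trans e (blowColor-inner i u v)))
    raise : ∀ s t u v → color (b i) s t ≡ color (b i) u v → blowColor (i , s) (i , t) ≡ blowColor (i , u) (i , v)
    raise s t u v e = trans (blowColor-inner i s t) (trans (cong (2 ↑ʳ_) e) (sym (blowColor-inner i u v)))

  -- With exactly two vertices in one part, an inner and an outer colour would have to agree; with
  -- three parts, the pentagon would contain a monochromatic triangle.
  blowColor-mono-outer : ∀ {i j l} x y z → ¬ (i ≡ j × j ≡ l) → mono blowColor (i , x) (j , y) (l , z) ≡ 0
  blowColor-mono-outer {i} {j} {l} x y z not-inner =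
    mono-≡0 blowColor {i , x} {j , y} {l , z} (λ (e , e′) → by (i ≟ j) (i ≟ l) (j ≟ l) e e′)
    where
    by : Dec (i ≡ j) → Dec (i ≡ l) → Dec (j ≡ l) → blowColor (i , x) (j , y) ≡ blowColor (i , x) (l , z) →
      ¬ blowColor (i , x) (j , y) ≡ blowColor (j , y) (l , z)
    by (yes refl) (yes refl) _ e e′ = not-inner (refl , refl)
    by (yes refl) (no i≢l) _ e e′ = inner≢outer x y x z i≢l e
    by (no i≢j) (yes refl) _ e e′ = inner≢outer x z x y i≢j (sym e)
    by (no i≢j) (no i≢l) (yes refl) e e′ = inner≢outer y z x y i≢j (sym e′)
    by (no i≢j) (no i≢l) (no j≢l) e e′ = pentagon-triangleFree i j l i≢j i≢l j≢l
      (lower x y x z i≢j i≢l e , lower x y y z i≢j j≢l e′)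
      where
      lower : ∀ {u u′ w w′} (s : V (b u)) (s′ : V (b u′)) (t : V (b w)) (t′ : V (b w′)) → u ≢ u′ → w ≢ w′ →
        blowColor (u , s) (u′ , s′) ≡ blowColor (w , t) (w′ , t′) → pentagon u u′ ≡ pentagon w w′
      lower {u} {u′} {w} {w′} s s′ t t′ ≢₁ ≢₂ e = toℕ-injective (trans (sym (toℕ-↑ˡ (pentagon u u′) k))
        (trans (cong toℕ (trans (sym (blowColor-outer s s′ ≢₁)) (trans e (blowColor-outer t t′ ≢₂)))) (toℕ-↑ˡ (pentagon w w′) k)))

  inPart : ∀ i → V (b i) → Vertex
  inPart i x = i , x

  part : Fin 5 → List Vertex
  part i = map (inPart i) (vertices (b i))

  parts : List (Fin 5) → List Vertex
  parts = concatMap part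

  ∈-part : ∀ {i v} → v ∈ part i → proj₁ v ≡ i
  ∈-part {i} v∈ with ∈-map⁻ (inPart i) v∈
  ... | _ , _ , refl = refl

  ∈-parts : ∀ {is v} → v ∈ parts is → proj₁ v ∈ is
  ∈-parts {is} v∈ with find (∈-concatMap⁻ part {xs = is} v∈)
  ... | i , i∈ , v∈i = subst (_∈ is) (sym (∈-part v∈i)) i∈

  length-parts : ∀ is → length (parts is) ≡ sumList (map (size ∘ b) is)
  length-parts [] = refl
  length-parts (i ∷ is) = trans (List.length-++ (part i))
    (cong₂ _+_ (List.length-map (inPart i) (vertices (b i))) (length-parts is))

  triples-parts : ∀ is → Unique is → triples (mono blowColor) (parts is) ≡ sumList (map (count ∘ b) is)
  triples-parts [] U = refl
  triples-parts (i ∷ is) (i∉ ∷ U) = trans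
    (triples-++ (mono blowColor) (part i) (parts is)
      (λ {x} {y} {z} x∈ y∈ z∈ → blowColor-mono-outer (proj₂ x) (proj₂ y) (proj₂ z)
        λ (e , e′) → All.lookup i∉ (∈-parts {is} z∈) (trans (sym (∈-part y∈)) e′))
      (λ {x} {y} {z} x∈ y∈ z∈ → blowColor-mono-outer (proj₂ x) (proj₂ y) (proj₂ z)
        λ (e , e′) → All.lookup i∉ (∈-parts {is} y∈) (trans (sym (∈-part x∈)) e)))
    (cong₂ _+_ (triples-map (inPart i) (mono (color (b i))) (mono blowColor) (blowColor-mono-inner i) (vertices (b i)))
      (triples-parts is U))

  blowUp : Block (2 + k)
  blowUp = record
    { color = blowColor ; color-sym = blowColor-sym ; nonRainbow = blowColor-nonRainbow ; vertices = parts (allFin 5) }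

  size-blowUp : size blowUp ≡ ∑[ i < 5 ] size (b i)
  size-blowUp = trans (length-parts (allFin 5)) (sumList-allFin 5 (size ∘ b))

  count-blowUp : count blowUp ≡ ∑[ i < 5 ] count (b i)
  count-blowUp = trans (triples-parts (allFin 5) (Unique.allFin⁺ 5)) (sumList-allFin 5 (count ∘ b))

-- Iterated substitution

total : ∀ {k n} → (Block k → ℕ) → Vec (Block k) n → ℕ
total μ [] = 0
total μ (b ∷ bs) = μ b + total μ bs

module _ {k} (μ : Block k → ℕ) where

  total-++ : ∀ {m n} (bs : Vec (Block k) m) (bs′ : Vec (Block k) n) → total μ (bs ++ᵛ bs′) ≡ total μ bs + total μ bs′
  total-++ [] bs′ = refl
  total-++ (b ∷ bs) bs′ = trans (cong (μ b +_) (total-++ bs bs′)) (sym (+-assoc (μ b) _ _))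

  total-concat : ∀ {m n} (bss : Vec (Vec (Block k) m) n) → total μ (concat bss) ≡ ∑[ i < n ] total μ (lookupᵛ bss i)
  total-concat [] = refl
  total-concat (bs ∷ bss) = trans (total-++ bs (concat bss)) (cong (total μ bs +_) (total-concat bss))

  total-replicate : ∀ n b → total μ (replicateᵛ n b) ≡ n * μ b
  total-replicate zero b = refl
  total-replicate (suc n) b = cong (μ b +_) (total-replicate n b)

-- The form `t * 2 + k` makes one more level equal to `2 + (t * 2 + k)` by computation.
iteratedBlowUp : ∀ {k} t → Vec (Block k) (5 ^ t) → Block (t * 2 + k)
iteratedBlowUp zero (b ∷ []) = b
iteratedBlowUp (suc t) bs = BlowUp.blowUp λ i → iteratedBlowUp t (lookupᵛ (proj₁ (group 5 (5 ^ t) bs)) i)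

mixedBlowUp : ∀ {k} t {r} → r ≤ 5 ^ t → (b₁ b₀ : Block k) → Block (t * 2 + k)
mixedBlowUp {k} t {r} r≤ b₁ b₀ =
  iteratedBlowUp t (subst (Vec (Block k)) (m+[n∸m]≡n r≤) (replicateᵛ r b₁ ++ᵛ replicateᵛ (5 ^ t ∸ r) b₀))

module _ {k : ℕ} (μ : ∀ {k} → Block k → ℕ)
  (μ-blowUp : ∀ {k} (b : Fin 5 → Block k) → μ (BlowUp.blowUp b) ≡ ∑[ i < 5 ] μ (b i)) where

  -- μ stands for `size` and for `count`, both additive under substitution.
  iteratedBlowUp-total : ∀ t (bs : Vec (Block k) (5 ^ t)) → μ (iteratedBlowUp t bs) ≡ total μ bs
  iteratedBlowUp-total zero (b ∷ []) = sym (+-identityʳ (μ b))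
  iteratedBlowUp-total (suc t) bs = trans (μ-blowUp λ i → iteratedBlowUp t (lookupᵛ bss i))
    (trans (sum-cong-≗ λ i → iteratedBlowUp-total t (lookupᵛ bss i))
      (trans (sym (total-concat μ bss)) (cong (total μ) (sym eq))))
    where
    bss = proj₁ (group 5 (5 ^ t) bs)
    eq = proj₂ (group 5 (5 ^ t) bs)

  mixedBlowUp-total : ∀ t {r} (r≤ : r ≤ 5 ^ t) (b₁ b₀ : Block k) →
    μ (mixedBlowUp t r≤ b₁ b₀) ≡ r * μ b₁ + (5 ^ t ∸ r) * μ b₀
  mixedBlowUp-total t {r} r≤ b₁ b₀ = trans (iteratedBlowUp-total t _)
    (trans (total-subst (m+[n∸m]≡n r≤) _) (trans (total-++ μ (replicateᵛ r b₁) _)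
      (cong₂ _+_ (total-replicate μ r b₁) (total-replicate μ (5 ^ t ∸ r) b₀))))
    where
    total-subst : ∀ {m n} (e : m ≡ n) (bs : Vec (Block k) m) → total μ (subst (Vec (Block k)) e bs) ≡ total μ bs
    total-subst refl bs = refl

-- Assembling the bounds

wlog-Ordered3 : ∀ {n} (P : Fin n → Fin n → Fin n → Set) →
  (∀ {x y z} → P x y z → P y x z) → (∀ {x y z} → P x y z → P x z y) →
  (∀ {x y z} → Ordered3 x y z → P x y z) → ∀ x y z → x ≢ y → x ≢ z → y ≢ z → P x y z
wlog-Ordered3 P swap₁₂ swap₂₃ base x y z x≢y x≢z y≢z with <-cmp (toℕ x) (toℕ y)
... | tri< x<y _ _ = place x<y x≢z y≢z
  where
  place : ∀ {x y z} → toℕ x < toℕ y → x ≢ z → y ≢ z → P x y z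
  place {x} {y} {z} x<y x≢z y≢z with <-cmp (toℕ y) (toℕ z) | <-cmp (toℕ x) (toℕ z)
  ... | tri< y<z _ _ | _ = base (x<y , y<z)
  ... | tri≈ _ y≡z _ | _ = ⊥-elim (y≢z (toℕ-injective y≡z))
  ... | tri> _ _ z<y | tri< x<z _ _ = swap₂₃ (base (x<z , z<y))
  ... | tri> _ _ z<y | tri≈ _ x≡z _ = ⊥-elim (x≢z (toℕ-injective x≡z))
  ... | tri> _ _ z<y | tri> _ _ z<x = swap₂₃ (swap₁₂ (base (z<x , x<y)))
... | tri≈ _ x≡y _ = ⊥-elim (x≢y (toℕ-injective x≡y))
... | tri> _ _ y<x with <-cmp (toℕ x) (toℕ z) | <-cmp (toℕ y) (toℕ z)
...   | tri< x<z _ _ | _ = swap₁₂ (base (y<x , x<z))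
...   | tri≈ _ x≡z _ | _ = ⊥-elim (x≢z (toℕ-injective x≡z))
...   | tri> _ _ z<x | tri< y<z _ _ = swap₁₂ (swap₂₃ (base (y<z , z<x)))
...   | tri> _ _ z<x | tri≈ _ y≡z _ = ⊥-elim (y≢z (toℕ-injective y≡z))
...   | tri> _ _ z<x | tri> _ _ z<y = swap₁₂ (swap₂₃ (swap₁₂ (base (z<y , y<x))))

module _ {k n} (c : Coloring k n) where

  -- A `Coloring` is meaningful only for i below j, whereas the structure theory needs a symmetric
  -- function.
  symmetrize : Coloring k n
  symmetrize i j = if does (toℕ i <? toℕ j) then c i j else c j i

  symmetrize-< : ∀ {i j} → toℕ i < toℕ j → symmetrize i j ≡ c i j
  symmetrize-< {i} {j} i<j = cong (if_then c i j else c j i) (dec-true (toℕ i <? toℕ j) i<j)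

  symmetrize-≮ : ∀ {i j} → ¬ toℕ i < toℕ j → symmetrize i j ≡ c j i
  symmetrize-≮ {i} {j} i≮j = cong (if_then c i j else c j i) (dec-false (toℕ i <? toℕ j) i≮j)

  symmetrize-sym : ∀ i j → symmetrize i j ≡ symmetrize j i
  symmetrize-sym i j with <-cmp (toℕ i) (toℕ j)
  ... | tri< i<j _ j≮i = trans (symmetrize-< i<j) (sym (symmetrize-≮ j≮i))
  ... | tri≈ _ i≡j _ rewrite toℕ-injective i≡j = refl
  ... | tri> i≮j _ j<i = trans (symmetrize-≮ i≮j) (sym (symmetrize-< j<i))

  symmetrize-nonRainbow : Gallai c → NonRainbow symmetrize
  symmetrize-nonRainbow G x y z = cases (x ≟ y) (x ≟ z) (y ≟ z)
    where
    s = symmetrize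
    P : Fin n → Fin n → Fin n → Set
    P x y z = s x y ≡ s x z ⊎ s x y ≡ s y z ⊎ s x z ≡ s y z
    swap₁₂ : ∀ {x y z} → P x y z → P y x z
    swap₁₂ {x} {y} (inj₁ e) = inj₂ (inj₁ (trans (symmetrize-sym y x) e))
    swap₁₂ {x} {y} (inj₂ (inj₁ e)) = inj₁ (trans (symmetrize-sym y x) e)
    swap₁₂ (inj₂ (inj₂ e)) = inj₂ (inj₂ (sym e))
    swap₂₃ : ∀ {x y z} → P x y z → P x z y
    swap₂₃ (inj₁ e) = inj₁ (sym e)
    swap₂₃ {x} {y} {z} (inj₂ (inj₁ e)) = inj₂ (inj₂ (trans e (symmetrize-sym y z)))
    swap₂₃ {x} {y} {z} (inj₂ (inj₂ e)) = inj₂ (inj₁ (trans e (symmetrize-sym y z)))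
    base : ∀ {x y z} → Ordered3 x y z → P x y z
    base {x} {y} {z} o@(x<y , y<z) = by (c x y ≟ c x z) (c x y ≟ c y z) (c x z ≟ c y z)
      where
      xy = symmetrize-< x<y
      yz = symmetrize-< y<z
      xz = symmetrize-< (<-trans x<y y<z)
      by : Dec (c x y ≡ c x z) → Dec (c x y ≡ c y z) → Dec (c x z ≡ c y z) → P x y z
      by (yes e) _ _ = inj₁ (trans xy (trans e (sym xz)))
      by (no _) (yes e) _ = inj₂ (inj₁ (trans xy (trans e (sym yz))))
      by (no _) (no _) (yes e) = inj₂ (inj₂ (trans xz (trans e (sym yz))))
      by (no ≢₁) (no ≢₂) (no ≢₃) = ⊥-elim (G x y z o (≢₁ , ≢₂ , ≢₃))
    cases : Dec (x ≡ y) → Dec (x ≡ z) → Dec (y ≡ z) → P x y z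
    cases (yes refl) _ _ = inj₂ (inj₂ refl)
    cases (no _) (yes refl) _ = inj₂ (inj₁ (symmetrize-sym x y))
    cases (no _) (no _) (yes refl) = inj₁ refl
    cases (no x≢y) (no x≢z) (no y≢z) = wlog-Ordered3 P
      (λ {x} {y} {z} → swap₁₂ {x} {y} {z}) (λ {x} {y} {z} → swap₂₃ {x} {y} {z}) base x y z x≢y x≢z y≢z

module _ {A : Set} {x y z : A} where

  ⊆-swap₁₂ : x ∷ y ∷ z ∷ [] ⊆ y ∷ x ∷ z ∷ []
  ⊆-swap₁₂ (here e) = there (here e)
  ⊆-swap₁₂ (there (here e)) = here e
  ⊆-swap₁₂ (there (there e)) = there (there e)

  ⊆-swap₂₃ : x ∷ y ∷ z ∷ [] ⊆ x ∷ z ∷ y ∷ []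
  ⊆-swap₂₃ (here e) = here e
  ⊆-swap₂₃ (there (here e)) = there (there (here e))
  ⊆-swap₂₃ (there (there (here e))) = there (here e)

module _ {k N} (c : Coloring k N) (G : Gallai c) where

  private
    s : Coloring k N
    s = symmetrize c

  open TriangleBounds _≟_ _≟_ s (symmetrize-sym c) (symmetrize-nonRainbow c G)
  open TriangleFreeBounds _≟_ _≟_ s (symmetrize-sym c) (symmetrize-nonRainbow c G)

  -- `monoCount` counts increasing triples, `Mono₃` any order. Mutual inclusion of the vertex lists
  -- links them and is all that `AtMostOne`, a statement on membership, requires.
  SortedTriangle : Fin N → Fin N → Fin N → Set
  SortedTriangle x y z = ∃ λ i → ∃₂ λ j l →
    Triangle c i j l × x ∷ y ∷ z ∷ [] ⊆ i ∷ j ∷ l ∷ [] × i ∷ j ∷ l ∷ [] ⊆ x ∷ y ∷ z ∷ []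

  Mono₃⇒SortedTriangle : ∀ {x y z} → Mono₃ x y z → SortedTriangle x y z
  Mono₃⇒SortedTriangle {x} {y} {z} m@(x≢y , x≢z , y≢z , _) =
    wlog-Ordered3 (λ x y z → Mono₃ x y z → SortedTriangle x y z)
      (λ f m → swap₁₂ (f (Mono₃-swap m))) (λ f m → swap₂₃ (f (Mono₃-swap (Mono₃-rotate (Mono₃-rotate m)))))
      base x y z x≢y x≢z y≢z m
    where
    swap₁₂ : ∀ {x y z} → SortedTriangle x y z → SortedTriangle y x z
    swap₁₂ (i , j , l , t , s₁ , s₂) = i , j , l , t , (λ v∈ → s₁ (⊆-swap₁₂ v∈)) , (λ v∈ → ⊆-swap₁₂ (s₂ v∈))
    swap₂₃ : ∀ {x y z} → SortedTriangle x y z → SortedTriangle x z y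
    swap₂₃ (i , j , l , t , s₁ , s₂) = i , j , l , t , (λ v∈ → s₁ (⊆-swap₂₃ v∈)) , (λ v∈ → ⊆-swap₂₃ (s₂ v∈))
    base : ∀ {x y z} → Ordered3 x y z → Mono₃ x y z → SortedTriangle x y z
    base {x} {y} {z} o@(x<y , y<z) (_ , _ , _ , e , e′) = x , y , z ,
      (o , trans (sym xy) (trans e (symmetrize-< c (<-trans x<y y<z))) , trans (sym xy) (trans e′ (symmetrize-< c y<z))) ,
      id , id
      where
      xy = symmetrize-< c x<y

  monoCount≤1⇒AtMostOne : monoCount c ≤ 1 → AtMostOne (allFin N)
  monoCount≤1⇒AtMostOne ≤1 {x} {y} {z} {x′} {y′} {z′} _ _ _ _ _ _ m m′ =
    same (Mono₃⇒SortedTriangle m) (Mono₃⇒SortedTriangle m′)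
    where
    same : SortedTriangle x y z → SortedTriangle x′ y′ z′ → x′ ∈ x ∷ y ∷ z ∷ []
    same (i , j , l , t , _ , ⊆xyz) (i′ , j′ , l′ , t′ , x′y′z′⊆ , _) with monoCount≤1-unique c ≤1 t t′
    ... | refl , refl , refl = ⊆xyz (x′y′z′⊆ (here refl))

  2≤monoCount : ∀ t → k ≤ t * 2 → 5 ^ t < N → 2 ≤ monoCount c
  2≤monoCount t k≤ 5^t<N = ≰⇒> λ ≤1 → <⇒≱ 5^t<N (≤-trans (≤-reflexive (sym (List.length-tabulate id)))
    (at-most-one-bound t (allFin k) (allFin N) (≤-trans (≤-reflexive (List.length-tabulate id)) k≤) (Unique.allFin⁺ N)
      (λ _ _ _ → ∈-allFin _) (monoCount≤1⇒AtMostOne ≤1)))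

restrict : ∀ {k n N} → N ≤ n → Coloring k n → Coloring k N
restrict N≤n c i j = c (inject≤ i N≤n) (inject≤ j N≤n)

module _ {k n N} (N≤n : N ≤ n) (c : Coloring k n) where

  inject≤-Ordered3 : ∀ {i j l : Fin N} → Ordered3 i j l → Ordered3 (inject≤ i N≤n) (inject≤ j N≤n) (inject≤ l N≤n)
  inject≤-Ordered3 {i} {j} {l} (i<j , j<l) =
    subst₂ _<_ (sym (toℕ-inject≤ i N≤n)) (sym (toℕ-inject≤ j N≤n)) i<j ,
    subst₂ _<_ (sym (toℕ-inject≤ j N≤n)) (sym (toℕ-inject≤ l N≤n)) j<l

  restrict-Gallai : Gallai c → Gallai (restrict N≤n c)
  restrict-Gallai G i j l o = G _ _ _ (inject≤-Ordered3 o)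

  restrict-HasMonoTriangle : HasMonoTriangle (restrict N≤n c) → HasMonoTriangle c
  restrict-HasMonoTriangle (i , j , l , o , m) = _ , _ , _ , inject≤-Ordered3 o , m

-- Otherwise the first N vertices of the block would already contain a monochromatic triangle.
GallaiForces⇒size< : ∀ {k N} → GallaiForces k N → (b : Block k) → Block.count b ≡ 0 → Block.size b < N
GallaiForces⇒size< F b count≡0 = ≰⇒> λ N≤ → <⇒≱
  (HasMonoTriangle⇒1≤monoCount coloring (restrict-HasMonoTriangle N≤ coloring
    (F (restrict N≤ coloring) (restrict-Gallai N≤ coloring coloring-Gallai))))
  (≤-reflexive (trans monoCount-coloring count≡0))
  where open Block b

-- A constant colouring is Gallai, and the triangle forced in it occupies three vertices.
GallaiForces⇒3≤ : ∀ {k N} → 1 ≤ k → GallaiForces k N → 3 ≤ N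
GallaiForces⇒3≤ (s≤s z≤n) F with F (λ _ _ → zero) (λ _ _ _ _ r → proj₁ r refl)
... | i , j , l , (i<j , j<l) , _ = ≤-trans (s≤s (≤-trans (s≤s (≤-trans (s≤s z≤n) i<j)) j<l)) (toℕ<n l)

GallaiForces-even⇒2≤monoCount : ∀ t {N} → GallaiForces (t * 2 + 2) N →
  (c : Coloring (t * 2 + 2) N) → Gallai c → 2 ≤ monoCount c
GallaiForces-even⇒2≤monoCount t {N} F c G = 2≤monoCount c G (suc t) (≤-reflexive (+-comm (t * 2) 2))
  (≤-trans (s≤s (≤-reflexive (trans (*-comm 5 (5 ^ t)) (sym size≡))))
    (GallaiForces⇒size< F b (trans count≡ (*-zeroʳ (5 ^ t)))))
  where
  -- With r = 0 every one of the 5^t blocks is a pentagon, which gives 5^(t+1) vertices without a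
  -- monochromatic triangle.
  b = mixedBlowUp t z≤n pentagonBlock pentagonBlock
  size≡ : Block.size b ≡ 5 ^ t * 5
  size≡ = mixedBlowUp-total Block.size BlowUp.size-blowUp t z≤n pentagonBlock pentagonBlock
  count≡ : Block.count b ≡ 5 ^ t * 0
  count≡ = mixedBlowUp-total Block.count BlowUp.count-blowUp t z≤n pentagonBlock pentagonBlock

-- The sizes match because 5^t m + r = r (m + 1) + (5^t - r) m.
IsGMin⇒≤mixedBlowUp : ∀ {k g m} t r (b₁ b₀ : Block k) → Block.size b₁ ≡ suc m → Block.size b₀ ≡ m →
  r < 5 ^ t → IsGMin (t * 2 + k) (5 ^ t * m + r) g →
  g ≤ r * Block.count b₁ + (5 ^ t ∸ r) * Block.count b₀
IsGMin⇒≤mixedBlowUp {k} {g} {m} t r b₁ b₀ size₁ size₀ r< min = ≤-trans (bound (5 ^ t * m + r) size≡ min)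
  (≤-reflexive (mixedBlowUp-total Block.count BlowUp.count-blowUp t (<⇒≤ r<) b₁ b₀))
  where
  b = mixedBlowUp t (<⇒≤ r<) b₁ b₀
  bound : ∀ n → n ≡ Block.size b → IsGMin (t * 2 + k) n g → g ≤ Block.count b
  bound n refl (_ , min) =
    ≤-trans (min (Block.coloring b) (Block.coloring-Gallai b)) (≤-reflexive (Block.monoCount-coloring b))
  e : ∀ r d m → (r + d) * m + r ≡ r * suc m + d * m
  e = solve-∀
  size≡ : 5 ^ t * m + r ≡ Block.size b
  size≡ = trans (cong (λ z → z * m + r) (sym (m+[n∸m]≡n (<⇒≤ r<)))) (trans (e r (5 ^ t ∸ r) m)
    (trans (cong₂ (λ x y → r * x + (5 ^ t ∸ r) * y) (sym size₁) (sym size₀))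
      (sym (mixedBlowUp-total Block.size BlowUp.size-blowUp t (<⇒≤ r<) b₁ b₀))))

constantBlock : ℕ → Block 1
constantBlock m = record
  { color = λ (_ _ : ⊤) → zero ; color-sym = λ _ _ → refl ; nonRainbow = λ _ _ _ → inj₁ refl ; vertices = replicate m tt }

-- Pascal's rule: a triple of positions contains the first one or does not.
count-constantBlock : ∀ m → Block.count (constantBlock m) ≡ m C 3
count-constantBlock zero = refl
count-constantBlock (suc m) = trans (cong₂ _+_ (pairs-replicate m) (count-constantBlock m)) (nCk+nC[k+1]≡[n+1]C[k+1] m 2)
  where
  sum-replicate : ∀ m → sumList (map (λ (_ : ⊤) → 1) (replicate m tt)) ≡ m
  sum-replicate zero = refl
  sum-replicate (suc m) = cong suc (sum-replicate m)
  pairs-replicate : ∀ m → pairs (λ (_ _ : ⊤) → 1) (replicate m tt) ≡ m C 2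
  pairs-replicate zero = refl
  pairs-replicate (suc m) = trans (cong₂ _+_ (trans (sum-replicate m) (sym (nC1≡n m))) (pairs-replicate m))
    (nCk+nC[k+1]≡[n+1]C[k+1] m 1)

twoColorBlock : ∀ {m} → Coloring 2 m → Block 2
twoColorBlock {m} c = record
  { color = symmetrize c
  ; color-sym = symmetrize-sym c
  ; nonRainbow = λ x y z → two-colors-nonRainbow (symmetrize c x y) (symmetrize c x z) (symmetrize c y z)
  ; vertices = allFin m
  }

count-twoColorBlock : ∀ {m} (c : Coloring 2 m) → Block.count (twoColorBlock c) ≡ monoCount c
count-twoColorBlock c = sym (monoCount≡triples c id (symmetrize c) λ _ _ i<j → sym (symmetrize-< c i<j))

upper-odd : ∀ t {n g m r} → IsGMin (t * 2 + 1) n g → n ≡ 5 ^ t * m + r → r < 5 ^ t →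
  g ≤ r * (suc m C 3) + (5 ^ t ∸ r) * (m C 3)
upper-odd t {g = g} {m} {r} min refl r< =
  subst₂ (λ x y → g ≤ r * x + (5 ^ t ∸ r) * y) (count-constantBlock (suc m)) (count-constantBlock m)
    (IsGMin⇒≤mixedBlowUp t r (constantBlock (suc m)) (constantBlock m)
      (List.length-replicate (suc m)) (List.length-replicate m) r< min)

upper-even : ∀ t {n g m r M₀ M₁} → IsGMin (t * 2 + 2) n g → n ≡ 5 ^ t * m + r → r < 5 ^ t →
  IsM2 m M₀ → IsM2 (suc m) M₁ → g ≤ r * M₁ + (5 ^ t ∸ r) * M₀
upper-even t {g = g} {m} {r} min refl r< ((c₀ , e₀) , _) ((c₁ , e₁) , _) =
  subst₂ (λ x y → g ≤ r * x + (5 ^ t ∸ r) * y) (trans (count-twoColorBlock c₁) e₁) (trans (count-twoColorBlock c₀) e₀)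
    (IsGMin⇒≤mixedBlowUp t r (twoColorBlock c₁) (twoColorBlock c₀)
      (List.length-tabulate id) (List.length-tabulate id) r< min)

odd-form : ∀ k → k % 2 ≡ 1 → k ≡ (k ∸ 1) / 2 * 2 + 1
odd-form k odd = go k (k / 2) (trans (m≡m%n+[m/n]*n k 2) (trans (cong (_+ k / 2 * 2) odd) (+-comm 1 (k / 2 * 2))))
  where
  go : ∀ k t → k ≡ t * 2 + 1 → k ≡ (k ∸ 1) / 2 * 2 + 1
  go k t refl = cong (λ s → s * 2 + 1) (sym (trans (cong (_/ 2) (m+n∸n≡m (t * 2) 1)) (m*n/n≡m t 2)))

-- For even k the exponent (k - 1) / 2 rounds down to (k - 2) / 2. Positivity excludes k = 0, where
-- the first equation fails.
even-form : ∀ k → 1 ≤ k → k % 2 ≡ 0 → k ≡ (k ∸ 1) / 2 * 2 + 2 × (k ∸ 2) / 2 ≡ (k ∸ 1) / 2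
even-form k 1≤k even = go k (k / 2) 1≤k (trans (m≡m%n+[m/n]*n k 2) (cong (_+ k / 2 * 2) even))
  where
  half : ∀ t → (1 + t * 2) / 2 ≡ t
  half t = trans (+-distrib-/-∣ʳ 1 {t * 2} {2} (divides t refl)) (m*n/n≡m t 2)
  go : ∀ k t → 1 ≤ k → k ≡ t * 2 → k ≡ (k ∸ 1) / 2 * 2 + 2 × (k ∸ 2) / 2 ≡ (k ∸ 1) / 2
  go k (suc t) 1≤k refl = trans (+-comm 2 (t * 2)) (cong (λ s → s * 2 + 2) (sym (half t))) ,
    trans (m*n/n≡m t 2) (sym (half t))

s0-odd : ∀ k → k % 2 ≡ 1 → s0 k ≡ 1
s0-odd k odd rewrite odd = refl

s0-even : ∀ k → k % 2 ≡ 0 → s0 k ≡ 2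
s0-even k even rewrite even = refl

k%2≡0⊎k%2≡1 : ∀ k → k % 2 ≡ 0 ⊎ k % 2 ≡ 1
k%2≡0⊎k%2≡1 k with k % 2 | m%n<n k 2
... | 0 | _ = inj₁ refl
... | 1 | _ = inj₂ refl
... | suc (suc _) | s≤s (s≤s ())

GallaiForces⇒s0≤monoCount : ∀ k {N} → 1 ≤ k → GallaiForces k N → (c : Coloring k N) → Gallai c → s0 k ≤ monoCount c
GallaiForces⇒s0≤monoCount k {N} 1≤k F = by (k%2≡0⊎k%2≡1 k)
  where
  Bound : ℕ → ℕ → Set
  Bound s k = GallaiForces k N → (c : Coloring k N) → Gallai c → s ≤ monoCount c
  by : k % 2 ≡ 0 ⊎ k % 2 ≡ 1 → (c : Coloring k N) → Gallai c → s0 k ≤ monoCount c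
  by (inj₁ even) = subst₂ Bound (sym (s0-even k even)) (sym (proj₁ (even-form k 1≤k even)))
    (GallaiForces-even⇒2≤monoCount ((k ∸ 1) / 2)) F
  by (inj₂ odd) c G = subst (_≤ monoCount c) (sym (s0-odd k odd)) (HasMonoTriangle⇒1≤monoCount c (F c G))

theorem1p4 : (k : ℕ) → 1 ≤ k → (N : ℕ) → IsGR k N → (n : ℕ) → N ≤ n →
    (g : ℕ) → IsGMin k n g →
    (m r : ℕ) → n ≡ 5 ^ ((k ∸ 1) / 2) * m + r → r < 5 ^ ((k ∸ 1) / 2) →
    (k % 2 ≡ 1 → g ≤ r * (suc m C 3) + (5 ^ ((k ∸ 1) / 2) ∸ r) * (m C 3))
    × (k % 2 ≡ 0 → (M₀ M₁ : ℕ) → IsM2 m M₀ → IsM2 (suc m) M₁ →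
    g ≤ r * M₁ + (5 ^ ((k ∸ 2) / 2) ∸ r) * M₀)
    × (s0 k * (n * (n ∸ 1) * (n ∸ 2)) ≤ g * (N * (N ∸ 1) * (N ∸ 2)))
theorem1p4 k 1≤k N (F , _) n N≤n g min@((c , G , refl) , _) m r n≡ r< =
  (λ odd → upper-odd ((k ∸ 1) / 2) (subst (λ k → IsGMin k n g) (odd-form k odd) min) n≡ r<) ,
  (λ even M₀ M₁ isM₀ isM₁ → subst (λ t → g ≤ r * M₁ + (5 ^ t ∸ r) * M₀) (sym (proj₂ (even-form k 1≤k even)))
    (upper-even ((k ∸ 1) / 2) (subst (λ k → IsGMin k n g) (proj₁ (even-form k 1≤k even)) min) n≡ r< isM₀ isM₁)) ,
  monoCount-averaging (s0 k) N (GallaiForces⇒3≤ 1≤k F) (GallaiForces⇒s0≤monoCount k 1≤k F) (≤⇒≤′ N≤n) c G
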